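{- Let $d\geq 3$. Then there exist constants $c_1,c_2\geq 0$ such that the following holds. For every positive integer $n$, there exists a family of $n$ axis-parallel boxes in $\mathbb{R}^d$ whose intersection graph has clique number at most $c_1\frac{\log n}{\log\log n}$ and independence number at most $c_2 n \left(\frac{\log n}{\log\log n}\right)^{ -(d-1)}$.
   Context: Boxes are closed axis-parallel boxes $\prod_{i=1}^d [a_i,b_i]$. The intersection graph of a family of sets has the members of the family as vertices, two joined by an edge if they have nonempty intersection. The constants $c_1,c_2$ depend only on $d$.
   Formalization: "Every positive integer n" becomes n ≥ 4, since for n = 1, 2 the quantity log log n is undefined or not positive and the bound fails (n = 3 is absorbed by the constants); log n and log log n are rounded-down base-2 logarithms, equivalent up to the constants. -}

module Defs where

open import Data.Nat using (ℕ)
open import Data.Integer using (ℤ; _≤_)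
open import Data.Fin using (Fin)
open import Data.Fin.Subset using (Subset; _∈_; ∣_∣)
open import Data.Nat renaming (_≤_ to _≤ℕ_) using (_*_)
open import Data.Nat.Logarithm using (⌊log₂_⌋)
open import Data.Product using (_×_; Σ; proj₁; proj₂)
open import Relation.Nullary using (¬_)
open import Relation.Binary.PropositionalEquality using (_≢_)

record Box (d : ℕ) : Set where
  constructor box
  field
    lo  : Fin d → ℤ
    hi  : Fin d → ℤ
    ok  : (i : Fin d) → lo i ≤ hi i
open Box public

-- Points of ℤ^d (for integer-endpoint boxes, a common real point exists
-- iff a common integer point exists).
Point : ℕ → Set
Point d = Fin d → ℤ

_∈Box_ : {d : ℕ} → Point d → Box d → Set
_∈Box_ {d} p B = (i : Fin d) → (lo B i ≤ p i) × (p i ≤ hi B i)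

Intersect : {d : ℕ} → Box d → Box d → Set
Intersect {d} B C = Σ (Point d) (λ p → (p ∈Box B) × (p ∈Box C))

-- A family of n boxes, indexed by Fin n; vertices of the intersection graph
-- are the indices, i ~ j (i ≠ j) iff the boxes intersect.
Family : ℕ → ℕ → Set
Family d n = Fin n → Box d

IsClique : {d n : ℕ} → Family d n → Subset n → Set
IsClique {d} {n} F S =
  (i j : Fin n) → i ∈ S → j ∈ S → i ≢ j → Intersect (F i) (F j)

IsIndependent : {d n : ℕ} → Family d n → Subset n → Set
IsIndependent {d} {n} F S =
  (i j : Fin n) → i ∈ S → j ∈ S → i ≢ j → ¬ Intersect (F i) (F j)

-- clique number ≤ num / den   (den > 0 in the use below):
-- every clique S satisfies ∣S∣ · den ≤ num.
CliqueNumberAtMost : {d n : ℕ} → Family d n → (num den : ℕ) → Set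
CliqueNumberAtMost {d} {n} F num den =
  (S : Subset n) → IsClique F S → ∣ S ∣ * den ≤ℕ num

IndependenceNumberAtMost : {d n : ℕ} → Family d n → (num den : ℕ) → Set
IndependenceNumberAtMost {d} {n} F num den =
  (S : Subset n) → IsIndependent F S → ∣ S ∣ * den ≤ℕ num

-- L n = ⌊log₂ n⌋ and LL n = ⌊log₂ ⌊log₂ n⌋⌋ (stand-ins for log n, log log n)
L : ℕ → ℕ
L n = ⌊log₂ n ⌋

LL : ℕ → ℕ
LL n = ⌊log₂ ⌊log₂ n ⌋ ⌋

-- Let k = 2^j ≈ log n / log log n, e = d - 1, T = k^e and b = T³. The boxes with side lengths
-- b^(ek - Σx), b^x₁, …, b^xₑ (0 ≤ xᵢ < k) form T shapes of equal volume; each shape tiles the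
-- grid, by c cells with n ≤ c ≤ 2n, and cells of different shapes meet in at most a 1/b
-- fraction of their volume. Take n independent uniformly random cells.
--
-- Pairwise intersecting boxes share a grid point (Helly). A point lies in T of the cT cells, so
-- Σ_w Σ_{S stabbed by w} k^|S| has expectation at most (number of points) * 4^k, which is
-- polynomial in n; hence |S| log k = O(log n) for every clique S.
--
-- Among any set of cells, those meeting fewer than about b others number at most 2c (second
-- moment of the depth). Choosing disjoint cells one at a time, each choice is therefore one of 2c
-- cells or discards b candidates, which bounds the expectation of Σ_{S independent} 4^|S| by
-- exp(O(c/T)); hence |S| = O(n/T) for every independent S.

module Submission where

open import Defs
open import Data.Nat using (ℕ; _≤_; _*_; _^_; _∸_)
open import Data.Product using (Σ; _×_)
open import Function.Definitions using (Injective)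
open import Relation.Binary.PropositionalEquality using (_≡_)

open import Data.Bool using (Bool; true; false; _∧_; not; if_then_else_) renaming (T to IsTrue)
open import Data.Fin using (Fin; zero; suc; toℕ)
import Data.Fin as Fin
open import Data.Fin.Properties using (toℕ<n; toℕ-injective)
open import Data.Fin.Subset using (Subset; ∣_∣; _∈_)
open import Data.Fin.Subset.Properties using (∣p∣≤n)
open import Data.Integer using (+≤+; drop‿+≤+) renaming (+_ to pos)
import Data.Integer.Properties as ℤ
open import Data.List using (List; []; _∷_; _++_; map; length; upTo; cartesianProductWith; cartesianProduct)
open import Data.List.Membership.Propositional using () renaming (_∈_ to _∈ˡ_)
open import Data.List.Membership.Propositional.Properties
  using (∈-upTo⁺; ∈-upTo⁻; ∈-cartesianProductWith⁺; ∈-cartesianProductWith⁻; ∈-cartesianProduct⁻)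
open import Data.List.Properties using (upTo-∷ʳ; length-upTo)
open import Data.List.Relation.Unary.Any using (here; there)
open import Data.Nat using (zero; suc; _+_; _/_; _%_; _⊔_; _⊓_; _<_; _<ᵇ_; _≡ᵇ_; z≤n; s≤s; pred; ⌊_/2⌋; ⌈_/2⌉; NonZero; >-nonZero; >-nonZero⁻¹)
open import Data.Nat.DivMod
open import Data.Nat.Divisibility using (_∣_; divides; ∣-trans; ∣n⇒∣m*n; *-pres-∣)
open import Data.Nat.Logarithm
open import Data.Nat.Properties
open import Algebra.Properties.CommutativeSemigroup +-commutativeSemigroup using () renaming (interchange to +-interchange)
open import Algebra.Properties.CommutativeSemigroup *-commutativeSemigroup using () renaming (interchange to *-interchange; x∙yz≈y∙xz to *-swapˡ)
open import Data.Nat.Tactic.RingSolver using (solve-∀)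
open import Data.Product using (∃; _,_; proj₁; proj₂)
open import Data.Sum using (_⊎_; inj₁; inj₂)
open import Data.Unit using (tt)
open import Data.Vec using (Vec; []; _∷_; lookup; replicate; zipWith; sum; tabulate; here; there)
import Data.Vec as Vec
open import Data.Vec.Properties using (≡-dec; lookup-map; lookup-replicate; lookup∘tabulate)
open import Relation.Binary.Definitions using (tri<; tri≈; tri>)
open import Relation.Binary.PropositionalEquality
open import Relation.Nullary using (yes; no; contradiction)

-- Finite sums over lists

private variable
  A B C : Set

⟦_⟧ : Bool → ℕ
⟦ b ⟧ = if b then 1 else 0

∑ : List A → (A → ℕ) → ℕ
∑ []       f = 0
∑ (x ∷ xs) f = f x + ∑ xs f

∑-cong : (xs : List A) {f g : A → ℕ} → (∀ x → f x ≡ g x) → ∑ xs f ≡ ∑ xs g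
∑-cong []       h = refl
∑-cong (x ∷ xs) h = cong₂ _+_ (h x) (∑-cong xs h)

∑-cong-∈ : (xs : List A) {f g : A → ℕ} → (∀ {x} → x ∈ˡ xs → f x ≡ g x) → ∑ xs f ≡ ∑ xs g
∑-cong-∈ []       h = refl
∑-cong-∈ (x ∷ xs) h = cong₂ _+_ (h (here refl)) (∑-cong-∈ xs λ p → h (there p))

∑-mono-∈ : (xs : List A) {f g : A → ℕ} → (∀ {x} → x ∈ˡ xs → f x ≤ g x) → ∑ xs f ≤ ∑ xs g
∑-mono-∈ []       h = z≤n
∑-mono-∈ (x ∷ xs) h = +-mono-≤ (h (here refl)) (∑-mono-∈ xs λ p → h (there p))

∑-mono : (xs : List A) {f g : A → ℕ} → (∀ x → f x ≤ g x) → ∑ xs f ≤ ∑ xs g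
∑-mono xs h = ∑-mono-∈ xs λ {x} _ → h x

∑-+ : (xs : List A) (f g : A → ℕ) → ∑ xs (λ x → f x + g x) ≡ ∑ xs f + ∑ xs g
∑-+ []       f g = refl
∑-+ (x ∷ xs) f g = trans (cong ((f x + g x) +_) (∑-+ xs f g)) (+-interchange (f x) (g x) _ _)

∑-*ˡ : (xs : List A) (k : ℕ) (f : A → ℕ) → ∑ xs (λ x → k * f x) ≡ k * ∑ xs f
∑-*ˡ []       k f = sym (*-zeroʳ k)
∑-*ˡ (x ∷ xs) k f = trans (cong (k * f x +_) (∑-*ˡ xs k f)) (sym (*-distribˡ-+ k (f x) _))

∑-*ʳ : (xs : List A) (k : ℕ) (f : A → ℕ) → ∑ xs (λ x → f x * k) ≡ ∑ xs f * k
∑-*ʳ xs k f = trans (∑-cong xs λ x → *-comm (f x) k) (trans (∑-*ˡ xs k f) (*-comm k _))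

∑-const : (xs : List A) (k : ℕ) → ∑ xs (λ _ → k) ≡ length xs * k
∑-const []       k = refl
∑-const (x ∷ xs) k = cong (k +_) (∑-const xs k)

∑-swap : (xs : List A) (ys : List B) (f : A → B → ℕ) →
  ∑ xs (λ x → ∑ ys (f x)) ≡ ∑ ys (λ y → ∑ xs (λ x → f x y))
∑-swap []       ys f = sym (trans (∑-const ys 0) (*-zeroʳ (length ys)))
∑-swap (x ∷ xs) ys f = trans (cong (∑ ys (f x) +_) (∑-swap xs ys f)) (sym (∑-+ ys (f x) _))

∑-++ : (xs ys : List A) (f : A → ℕ) → ∑ (xs ++ ys) f ≡ ∑ xs f + ∑ ys f
∑-++ []       ys f = refl
∑-++ (x ∷ xs) ys f = trans (cong (f x +_) (∑-++ xs ys f)) (sym (+-assoc (f x) _ _))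

∑-map : (g : B → A) (ys : List B) (f : A → ℕ) → ∑ (map g ys) f ≡ ∑ ys (λ y → f (g y))
∑-map g []       f = refl
∑-map g (y ∷ ys) f = cong (f (g y) +_) (∑-map g ys f)

∑-cartesianProductWith : (g : A → B → C) (xs : List A) (ys : List B) (f : C → ℕ) →
  ∑ (cartesianProductWith g xs ys) f ≡ ∑ xs (λ x → ∑ ys (λ y → f (g x y)))
∑-cartesianProductWith g []       ys f = refl
∑-cartesianProductWith g (x ∷ xs) ys f =
  trans (∑-++ (map (g x) ys) _ f)
        (cong₂ _+_ (∑-map (g x) ys f) (∑-cartesianProductWith g xs ys f))

term≤∑ : {xs : List A} {x : A} (f : A → ℕ) → x ∈ˡ xs → f x ≤ ∑ xs f
term≤∑ f (here refl) = m≤m+n (f _) _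
term≤∑ {xs = y ∷ _} f (there p) = ≤-trans (term≤∑ f p) (m≤n+m _ (f y))

∑>0⇒term>0 : (xs : List A) (f : A → ℕ) → 0 < ∑ xs f → ∃ λ x → x ∈ˡ xs × 0 < f x
∑>0⇒term>0 (x ∷ xs) f h with f x in eq
... | suc _ = x , here refl , subst (0 <_) (sym eq) (s≤s z≤n)
... | zero  = let y , p , q = ∑>0⇒term>0 xs f h in y , there p , q

term≤average : (xs : List A) (g : A → ℕ) (a : ℕ) → 0 < length xs →
  ∑ xs g ≤ a * length xs → ∃ λ x → x ∈ˡ xs × g x ≤ a
term≤average xs g a 0<len h = go xs (≤-<-trans h (*-monoˡ-< (length xs) {{>-nonZero 0<len}} (n<1+n a)))
  where
  -- The strict bound with `suc a` survives the passage to the tail: a head with `g x > a` uses up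
  -- at least `suc a`.
  go : ∀ xs → ∑ xs g < suc a * length xs → ∃ λ x → x ∈ˡ xs × g x ≤ a
  go [] h = contradiction (subst (0 <_) (*-zeroʳ a) h) λ ()
  go (x ∷ xs) h with g x ≤? a
  ... | yes p = x , here refl , p
  ... | no p  =
    let y , q , r = go xs (+-cancelˡ-< (suc a) _ _
                      (≤-<-trans (+-monoˡ-≤ (∑ xs g) (≰⇒> p)) (subst (g x + ∑ xs g <_) (*-suc (suc a) (length xs)) h)))
    in y , there q , r

-- Vectors of independent choices

choices : ∀ {n} → Vec (List A) n → List (Vec A n)
choices []       = [] ∷ []
choices (L ∷ Ls) = cartesianProductWith _∷_ L (choices Ls)

∑-choices : ∀ {n} (L : List A) (Ls : Vec (List A) n) (f : Vec A (suc n) → ℕ) →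
  ∑ (choices (L ∷ Ls)) f ≡ ∑ L (λ x → ∑ (choices Ls) (λ v → f (x ∷ v)))
∑-choices L Ls = ∑-cartesianProductWith _∷_ L (choices Ls)

lookup-∈-choices : ∀ {n} (Ls : Vec (List A) n) {v : Vec A n} → v ∈ˡ choices Ls →
  ∀ i → lookup v i ∈ˡ lookup Ls i
lookup-∈-choices (L ∷ Ls) {x ∷ v} p i with ∈-cartesianProductWith⁻ _∷_ L (choices Ls) p
... | _ , _ , x∈ , v∈ , refl with i
...   | zero  = x∈
...   | suc i = lookup-∈-choices Ls v∈ i

length≡∑1 : (xs : List A) → length xs ≡ ∑ xs (λ _ → 1)
length≡∑1 xs = sym (trans (∑-const xs 1) (*-identityʳ _))

length-choices-replicate : (L : List A) (n : ℕ) → length (choices (replicate n L)) ≡ length L ^ n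
length-choices-replicate L zero    = refl
length-choices-replicate L (suc n) = begin
  length (choices (L ∷ replicate n L))                    ≡⟨ length≡∑1 (choices (L ∷ replicate n L)) ⟩
  ∑ (choices (L ∷ replicate n L)) (λ _ → 1)               ≡⟨ ∑-choices L (replicate n L) _ ⟩
  ∑ L (λ _ → ∑ (choices (replicate n L)) (λ _ → 1))       ≡⟨ ∑-cong L (λ _ → sym (length≡∑1 (choices (replicate n L)))) ⟩
  ∑ L (λ _ → length (choices (replicate n L)))            ≡⟨ ∑-const L _ ⟩
  length L * length (choices (replicate n L))             ≡⟨ cong (length L *_) (length-choices-replicate L n) ⟩
  length L * length L ^ n ∎
  where open ≡-Reasoning

-- Cliques and packings in a random sample

⟦⟧≤1 : ∀ p → ⟦ p ⟧ ≤ 1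
⟦⟧≤1 false = z≤n
⟦⟧≤1 true  = ≤-refl

2ab≤a²+b² : ∀ a b → 2 * (a * b) ≤ a * a + b * b
2ab≤a²+b² a b with ≤-total a b
... | inj₁ a≤b with t , refl ← m≤n⇒∃[o]m+o≡n a≤b =
  ≤-trans (m≤m+n _ (t * t)) (≤-reflexive (square a t))
  where
  square : ∀ a t → 2 * (a * (a + t)) + t * t ≡ a * a + (a + t) * (a + t)
  square = solve-∀
... | inj₂ b≤a with t , refl ← m≤n⇒∃[o]m+o≡n b≤a =
  ≤-trans (m≤m+n _ (t * t)) (≤-reflexive (square b t))
  where
  square : ∀ b t → 2 * ((b + t) * b) + t * t ≡ (b + t) * (b + t) + b * b
  square = solve-∀

common : {B P : Set} → List P → (B → P → ℕ) → B → B → ℕ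
common Π c v u = ∑ Π (λ w → c v w * c u w)

-- The probabilistic argument, separated from the geometry. In the application `T` counts the
-- shapes, `V` the grid points, and `s` is the volume of a cell. Every cell is listed `s` times in
-- `Ω`, and all counts over `Ω` carry this factor. `common≤` allows an overlap of `s` for copies of
-- one cell, plus `s / b` for any two that meet.
module Sample
  {B P : Set} (Ω : List B) (Π : List P) (c : B → P → ℕ) (same : B → B → ℕ)
  (T V s b : ℕ) {{_ : NonZero T}} {{_ : NonZero s}} {{_ : NonZero b}}
  (|Ω| : length Ω ≡ T * V) (|Π| : length Π ≡ V)
  (∑-cell : ∀ {v} → v ∈ˡ Ω → ∑ Π (c v) ≡ s)
  (∑-stab : ∀ {w} → w ∈ˡ Π → ∑ Ω (λ v → c v w) ≡ T * s)
  (∑-same : ∀ {v} → v ∈ˡ Ω → ∑ Ω (same v) ≤ s)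
  (common≤ : ∀ {v u} → v ∈ˡ Ω → u ∈ˡ Ω →
     b * common Π c v u ≤ b * s * same v u + s * ⟦ not (common Π c v u ≡ᵇ 0) ⟧)
  where

  meets : B → B → Bool
  meets v u = not (common Π c v u ≡ᵇ 0)

  size : (B → Bool) → ℕ
  size χ = ∑ Ω (λ u → ⟦ χ u ⟧)

  degree : (B → Bool) → B → ℕ
  degree χ v = ∑ Ω (λ u → ⟦ χ u ⟧ * ⟦ meets v u ⟧)

  avoiding : (B → Bool) → B → B → Bool
  avoiding χ v u = χ u ∧ not (meets v u)

  size-avoiding : ∀ χ v → size (avoiding χ v) + degree χ v ≡ size χ
  size-avoiding χ v = trans (sym (∑-+ Ω _ _)) (∑-cong Ω λ u → split (χ u) (meets v u))
    where
    split : ∀ p q → ⟦ p ∧ not q ⟧ + ⟦ p ⟧ * ⟦ q ⟧ ≡ ⟦ p ⟧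
    split false q     = refl
    split true  false = refl
    split true  true  = refl

  -- Degrees count all `s` copies of a cell, so the threshold `b * s` stands for `b` different
  -- cells.
  low : (B → Bool) → B → ℕ
  low χ v = ⟦ χ v ⟧ * ⟦ degree χ v <ᵇ b * s ⟧

  low≤ : ∀ χ v → low χ v ≤ ⟦ χ v ⟧
  low≤ χ v = ≤-trans (*-monoʳ-≤ ⟦ χ v ⟧ (⟦⟧≤1 (degree χ v <ᵇ b * s))) (≤-reflexive (*-identityʳ _))

  module _ (χ : B → Bool) where
    private
      y : B → ℕ
      y = low χ
      Y : ℕ
      Y = ∑ Ω y
      depth : P → ℕ
      depth w = ∑ Ω (λ v → y v * c v w)

    ∑-depth : ∑ Π depth ≡ Y * s
    ∑-depth = begin
      ∑ Π depth                              ≡⟨ ∑-swap Π Ω _ ⟩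
      ∑ Ω (λ v → ∑ Π (λ w → y v * c v w))    ≡⟨ ∑-cong-∈ Ω (λ {v} v∈ → trans (∑-*ˡ Π (y v) (c v)) (cong (y v *_) (∑-cell v∈))) ⟩
      ∑ Ω (λ v → y v * s)                    ≡⟨ ∑-*ʳ Ω s y ⟩
      Y * s ∎
      where open ≡-Reasoning

    ∑-depth² : ∑ Π (λ w → depth w * depth w) ≡ ∑ Ω (λ v → y v * ∑ Ω (λ u → y u * common Π c v u))
    ∑-depth² = begin
      ∑ Π (λ w → depth w * depth w)
        ≡⟨ ∑-cong Π (λ w → sym (∑-*ʳ Ω (depth w) _)) ⟩
      ∑ Π (λ w → ∑ Ω (λ v → y v * c v w * depth w))
        ≡⟨ ∑-swap Π Ω _ ⟩
      ∑ Ω (λ v → ∑ Π (λ w → y v * c v w * depth w))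
        ≡⟨ ∑-cong Ω (λ v → trans (∑-cong Π λ w → *-assoc (y v) (c v w) _) (∑-*ˡ Π (y v) _)) ⟩
      ∑ Ω (λ v → y v * ∑ Π (λ w → c v w * depth w))
        ≡⟨ ∑-cong Ω (λ v → cong (y v *_) (inner v)) ⟩
      ∑ Ω (λ v → y v * ∑ Ω (λ u → y u * common Π c v u)) ∎
      where
      open ≡-Reasoning
      inner : ∀ v → ∑ Π (λ w → c v w * depth w) ≡ ∑ Ω (λ u → y u * common Π c v u)
      inner v = begin
        ∑ Π (λ w → c v w * depth w)                         ≡⟨ ∑-cong Π (λ w → sym (∑-*ˡ Ω (c v w) _)) ⟩
        ∑ Π (λ w → ∑ Ω (λ u → c v w * (y u * c u w)))       ≡⟨ ∑-swap Π Ω _ ⟩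
        ∑ Ω (λ u → ∑ Π (λ w → c v w * (y u * c u w)))       ≡⟨ ∑-cong Ω (λ u → trans (∑-cong Π λ w → *-swapˡ (c v w) (y u) (c u w)) (∑-*ˡ Π (y u) _)) ⟩
        ∑ Ω (λ u → y u * common Π c v u) ∎

    -- The copies of `v` itself contribute at most `s * s`. A low `v` meets fewer than `b * s`
    -- members of `χ`, each adding at most `s / b`, which is `s * s` again.
    low-common : ∀ {v} → v ∈ˡ Ω →
      y v * (b * ∑ Ω (λ u → y u * common Π c v u)) ≤ y v * (b * (2 * (s * s)))
    low-common {v} v∈ with χ v | degree χ v <ᵇ b * s in eq
    ... | false | _     = z≤n
    ... | true  | false = z≤n
    ... | true  | true  = *-monoʳ-≤ 1 (begin
      b * ∑ Ω (λ u → y u * common Π c v u)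
        ≡⟨ ∑-*ˡ Ω b _ ⟨
      ∑ Ω (λ u → b * (y u * common Π c v u))
        ≤⟨ ∑-mono-∈ Ω (λ {u} u∈ → pointwise u u∈) ⟩
      ∑ Ω (λ u → b * s * same v u + s * (⟦ χ u ⟧ * ⟦ meets v u ⟧))
        ≡⟨ ∑-+ Ω _ _ ⟩
      ∑ Ω (λ u → b * s * same v u) + ∑ Ω (λ u → s * (⟦ χ u ⟧ * ⟦ meets v u ⟧))
        ≡⟨ cong₂ _+_ (∑-*ˡ Ω (b * s) _) (∑-*ˡ Ω s _) ⟩
      b * s * ∑ Ω (same v) + s * degree χ v
        ≤⟨ +-mono-≤ (*-monoʳ-≤ (b * s) (∑-same v∈)) (*-monoʳ-≤ s (<⇒≤ (<ᵇ⇒< (degree χ v) (b * s) (subst IsTrue (sym eq) tt)))) ⟩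
      b * s * s + s * (b * s)
        ≡⟨ collect b s ⟩
      b * (2 * (s * s)) ∎)
      where
      open ≤-Reasoning
      collect : ∀ b s → b * s * s + s * (b * s) ≡ b * (2 * (s * s))
      collect = solve-∀
      pointwise : ∀ u → u ∈ˡ Ω →
        b * (y u * common Π c v u) ≤ b * s * same v u + s * (⟦ χ u ⟧ * ⟦ meets v u ⟧)
      pointwise u u∈ = begin
        b * (y u * common Π c v u)                                ≡⟨ *-swapˡ b (y u) _ ⟩
        y u * (b * common Π c v u)                                ≤⟨ *-monoʳ-≤ (y u) (common≤ v∈ u∈) ⟩
        y u * (b * s * same v u + s * ⟦ meets v u ⟧)               ≡⟨ *-distribˡ-+ (y u) (b * s * same v u) _ ⟩
        y u * (b * s * same v u) + y u * (s * ⟦ meets v u ⟧)       ≤⟨ +-mono-≤ (*-monoˡ-≤ _ (≤-trans (low≤ χ u) (⟦⟧≤1 (χ u)))) (*-monoˡ-≤ _ (low≤ χ u)) ⟩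
        1 * (b * s * same v u) + ⟦ χ u ⟧ * (s * ⟦ meets v u ⟧)     ≡⟨ cong₂ _+_ (*-identityˡ _) (*-swapˡ ⟦ χ u ⟧ s _) ⟩
        b * s * same v u + s * (⟦ χ u ⟧ * ⟦ meets v u ⟧) ∎

    -- Second moment method: over the `V` points the depths sum to `Y * s`, while by `low-common`
    -- their squares sum to at most `2 * s * s * Y`. Cauchy-Schwarz would conclude.
    few-low : Y ≤ 2 * V
    few-low = *-cancelˡ-≤ (2 * (s * s)) {{m*n≢0 2 (s * s) {{_}} {{m*n≢0 s s}}}}
      (+-cancelʳ-≤ (Y * (2 * (s * s))) _ _ (begin
        2 * (s * s) * Y + Y * (2 * (s * s))          ≡⟨ lhs s Y ⟩
        2 * (2 * s * (Y * s))                        ≡⟨ cong (λ z → 2 * (2 * s * z)) ∑-depth ⟨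
        2 * (2 * s * ∑ Π depth)                      ≡⟨ cong (2 *_) (∑-*ˡ Π (2 * s) depth) ⟨
        2 * ∑ Π (λ w → 2 * s * depth w)              ≡⟨ ∑-*ˡ Π 2 _ ⟨
        -- The inequality of means against the constant `2 * s` replaces Cauchy-Schwarz. Since
        -- `2 * s` is the ratio of the two moment bounds, nothing is lost.
        ∑ Π (λ w → 2 * (2 * s * depth w))            ≤⟨ ∑-mono Π (λ w → 2ab≤a²+b² (2 * s) (depth w)) ⟩
        ∑ Π (λ w → 2 * s * (2 * s) + depth w * depth w) ≡⟨ ∑-+ Π _ _ ⟩
        ∑ Π (λ w → 2 * s * (2 * s)) + ∑ Π (λ w → depth w * depth w)
          ≤⟨ +-mono-≤ (≤-reflexive (trans (∑-const Π _) (cong (_* (2 * s * (2 * s))) |Π|))) sq ⟩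
        V * (2 * s * (2 * s)) + Y * (2 * (s * s))    ≡⟨ cong (_+ Y * (2 * (s * s))) (rhs s V) ⟩
        2 * (s * s) * (2 * V) + Y * (2 * (s * s)) ∎))
      where
      open ≤-Reasoning
      lhs : ∀ s Y → 2 * (s * s) * Y + Y * (2 * (s * s)) ≡ 2 * (2 * s * (Y * s))
      lhs = solve-∀
      rhs : ∀ s V → V * (2 * s * (2 * s)) ≡ 2 * (s * s) * (2 * V)
      rhs = solve-∀
      sq : ∑ Π (λ w → depth w * depth w) ≤ Y * (2 * (s * s))
      sq = *-cancelˡ-≤ b (begin
        b * ∑ Π (λ w → depth w * depth w)                              ≡⟨ cong (b *_) ∑-depth² ⟩
        b * ∑ Ω (λ v → y v * ∑ Ω (λ u → y u * common Π c v u))        ≡⟨ ∑-*ˡ Ω b _ ⟨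
        ∑ Ω (λ v → b * (y v * ∑ Ω (λ u → y u * common Π c v u)))      ≡⟨ ∑-cong Ω (λ v → *-swapˡ b (y v) _) ⟩
        ∑ Ω (λ v → y v * (b * ∑ Ω (λ u → y u * common Π c v u)))      ≤⟨ ∑-mono-∈ Ω low-common ⟩
        ∑ Ω (λ v → y v * (b * (2 * (s * s))))                          ≡⟨ ∑-*ʳ Ω _ y ⟩
        Y * (b * (2 * (s * s)))                                        ≡⟨ *-swapˡ Y b _ ⟩
        b * (Y * (2 * (s * s))) ∎)

  module _ (W : ℕ) where

    -- A generating function: unfolding the recursion gives the sum of `W ^ ∣ S ∣` over all sets `S`
    -- of positions whose boxes satisfy `χ` and pairwise do not meet.
    packings : ∀ {n} → (B → Bool) → Vec B n → ℕ
    packings χ []      = 1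
    packings χ (v ∷ f) = packings χ f + W * (⟦ χ v ⟧ * packings (avoiding χ v) f)

    ∑packings : ℕ → (B → Bool) → ℕ
    ∑packings n χ = ∑ (choices (replicate n Ω)) (packings χ)

    ∑packings-suc : ∀ n χ → ∑packings (suc n) χ ≡
      T * V * ∑packings n χ + W * ∑ Ω (λ v → ⟦ χ v ⟧ * ∑packings n (avoiding χ v))
    ∑packings-suc n χ = begin
      ∑packings (suc n) χ
        ≡⟨ ∑-choices Ω (replicate n Ω) _ ⟩
      ∑ Ω (λ v → ∑ fs (λ f → packings χ f + W * (⟦ χ v ⟧ * packings (avoiding χ v) f)))
        ≡⟨ ∑-cong Ω (λ v → trans (∑-+ fs _ _) (cong (∑packings n χ +_)
             (trans (∑-*ˡ fs W _) (cong (W *_) (∑-*ˡ fs ⟦ χ v ⟧ _))))) ⟩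
      ∑ Ω (λ v → ∑packings n χ + W * (⟦ χ v ⟧ * ∑packings n (avoiding χ v)))
        ≡⟨ ∑-+ Ω _ _ ⟩
      ∑ Ω (λ v → ∑packings n χ) + ∑ Ω (λ v → W * (⟦ χ v ⟧ * ∑packings n (avoiding χ v)))
        ≡⟨ cong₂ _+_ (trans (∑-const Ω _) (cong (_* ∑packings n χ) |Ω|)) (∑-*ˡ Ω W _) ⟩
      T * V * ∑packings n χ + W * ∑ Ω (λ v → ⟦ χ v ⟧ * ∑packings n (avoiding χ v)) ∎
      where
      open ≡-Reasoning
      fs = choices (replicate n Ω)

    -- Every box chosen for a packing either is one of the at most 2V boxes of low degree among the
    -- remaining candidates, or eliminates b * s of them, which can happen at most r times.
    ∑packings≤ : ∀ n r χ → size χ < r * (b * s) →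
      ∑packings n χ ≤ (V * (T + 3 * W)) ^ n * T ^ r
    ∑packings≤ zero    r χ h = ≤-trans (m^n>0 T r) (≤-reflexive (sym (*-identityˡ _)))
    ∑packings≤ (suc n) r χ h = begin
      ∑packings (suc n) χ                       ≡⟨ ∑packings-suc n χ ⟩
      T * V * ∑packings n χ + W * ∑ Ω branch    ≤⟨ +-mono-≤ (*-monoʳ-≤ (T * V) (∑packings≤ n r χ h)) (*-monoʳ-≤ W ∑branch) ⟩
      T * V * X + W * (3 * V * X)               ≡⟨ collect T V W (K ^ n) (T ^ r) ⟩
      K ^ suc n * T ^ r ∎
      where
      open ≤-Reasoning
      K = V * (T + 3 * W)
      X = K ^ n * T ^ r
      branch : B → ℕ
      branch v = ⟦ χ v ⟧ * ∑packings n (avoiding χ v)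
      collect : ∀ T V W a t → T * V * (a * t) + W * (3 * V * (a * t)) ≡ V * (T + 3 * W) * a * t
      collect = solve-∀
      total : ∀ T V X → 2 * V * (T * X) + T * V * X ≡ T * (3 * V * X)
      total = solve-∀
      -- Choosing a box of high degree lowers `r` by one and so gains a factor `T`; the power
      -- `T ^ r` is the budget for such choices.
      high : ∀ v → b * s ≤ degree χ v → ∀ r → size χ < r * (b * s) → T * ∑packings n (avoiding χ v) ≤ K ^ n * T ^ r
      high v d≥ (suc r) h = begin
        T * ∑packings n (avoiding χ v)   ≤⟨ *-monoʳ-≤ T (∑packings≤ n r (avoiding χ v) smaller) ⟩
        T * (K ^ n * T ^ r)              ≡⟨ *-swapˡ T (K ^ n) (T ^ r) ⟩
        K ^ n * T ^ suc r ∎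
        where
        smaller : size (avoiding χ v) < r * (b * s)
        smaller = +-cancelˡ-< (b * s) _ _ (begin-strict
          b * s + size (avoiding χ v)          ≤⟨ +-monoˡ-≤ _ d≥ ⟩
          degree χ v + size (avoiding χ v)     ≡⟨ +-comm (degree χ v) _ ⟩
          size (avoiding χ v) + degree χ v     ≡⟨ size-avoiding χ v ⟩
          size χ                               <⟨ h ⟩
          b * s + r * (b * s) ∎)
      shrink : ∀ v → size (avoiding χ v) < r * (b * s)
      shrink v = ≤-<-trans (≤-trans (m≤m+n _ (degree χ v)) (≤-reflexive (size-avoiding χ v))) h
      -- After division by `T`: the low boxes contribute at most `2 * V * X` in all, and the others,
      -- at most `T * V` in number, only `X / T` each. This is the origin of `3 * V` and of
      -- `T + 3 * W`.
      Tbranch≤ : ∀ v → T * branch v ≤ low χ v * (T * X) + X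
      Tbranch≤ v with χ v | degree χ v <ᵇ b * s in eq
      ... | false | _     = ≤-trans (≤-reflexive (*-zeroʳ T)) z≤n
      ... | true  | true  = ≤-trans (*-monoʳ-≤ T (*-monoʳ-≤ 1 (∑packings≤ n r (avoiding χ v) (shrink v))))
                             (≤-trans (≤-reflexive (one T X)) (m≤m+n _ X))
        where
        one : ∀ T X → T * (1 * X) ≡ 1 * (T * X)
        one = solve-∀
      ... | true  | false = ≤-trans (≤-reflexive (cong (T *_) (*-identityˡ _)))
                              (high v (≮⇒≥ (λ d< → subst IsTrue eq (<⇒<ᵇ d<))) r h)
      ∑branch : ∑ Ω branch ≤ 3 * V * X
      ∑branch = *-cancelˡ-≤ T (begin
        T * ∑ Ω branch                              ≡⟨ ∑-*ˡ Ω T branch ⟨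
        ∑ Ω (λ v → T * branch v)                    ≤⟨ ∑-mono Ω Tbranch≤ ⟩
        ∑ Ω (λ v → low χ v * (T * X) + X)           ≡⟨ ∑-+ Ω _ _ ⟩
        ∑ Ω (λ v → low χ v * (T * X)) + ∑ Ω (λ _ → X)
          ≡⟨ cong₂ _+_ (∑-*ʳ Ω (T * X) (low χ)) (trans (∑-const Ω X) (cong (_* X) |Ω|)) ⟩
        ∑ Ω (low χ) * (T * X) + T * V * X           ≤⟨ +-monoˡ-≤ _ (*-monoˡ-≤ (T * X) (few-low χ)) ⟩
        2 * V * (T * X) + T * V * X                 ≡⟨ total T V X ⟩
        T * (3 * V * X) ∎)

    -- `W ^ ∣ S ∣` is one summand of `packings χ f`, reached by skipping or taking each box as `S`
    -- prescribes.
    packing-weight : ∀ {n} χ (f : Vec B n) (S : Subset n) →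
      (∀ {i} → i ∈ S → χ (lookup f i) ≡ true) →
      (∀ {i j} → i ∈ S → j ∈ S → i ≢ j → meets (lookup f i) (lookup f j) ≡ false) →
      W ^ ∣ S ∣ ≤ packings χ f
    packing-weight χ []      []          hχ hS = ≤-refl
    packing-weight χ (v ∷ f) (false ∷ S) hχ hS =
      ≤-trans (packing-weight χ f S (λ i∈ → hχ (there i∈))
                (λ i∈ j∈ i≢j → hS (there i∈) (there j∈) λ { refl → i≢j refl }))
              (m≤m+n _ _)
    packing-weight χ (v ∷ f) (true ∷ S) hχ hS =
      ≤-trans (*-monoʳ-≤ W (≤-trans
                 (packing-weight (avoiding χ v) f S
                   (λ i∈ → cong₂ _∧_ (hχ (there i∈)) (cong not (hS here (there i∈) λ ())))
                   (λ i∈ j∈ i≢j → hS (there i∈) (there j∈) λ { refl → i≢j refl }))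
                 (≤-reflexive (sym (trans (cong (λ p → ⟦ p ⟧ * packings (avoiding χ v) f) (hχ here)) (*-identityˡ _))))))
              (m≤n+m _ (packings χ f))

  module _ (U : ℕ) where

    -- For incidences 0 and 1, expanding the product gives the sum of `U ^ ∣ S ∣` over all sets `S`
    -- of positions whose boxes contain `w`.
    stabs : ∀ {n} → P → Vec B n → ℕ
    stabs w []      = 1
    stabs w (v ∷ f) = (1 + U * c v w) * stabs w f

    -- The draws are independent, so the sum over all samples factorises into `n` equal factors.
    ∑-stabs : ∀ n {w} → w ∈ˡ Π → ∑ (choices (replicate n Ω)) (stabs w) ≡ (T * V + U * (T * s)) ^ n
    ∑-stabs zero    w∈ = refl
    ∑-stabs (suc n) {w} w∈ = begin
      ∑ (choices (replicate (suc n) Ω)) (stabs w)             ≡⟨ ∑-choices Ω (replicate n Ω) _ ⟩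
      ∑ Ω (λ v → ∑ fs (λ f → (1 + U * c v w) * stabs w f))    ≡⟨ ∑-cong Ω (λ v → ∑-*ˡ fs (1 + U * c v w) _) ⟩
      ∑ Ω (λ v → (1 + U * c v w) * ∑ fs (stabs w))            ≡⟨ ∑-*ʳ Ω _ _ ⟩
      ∑ Ω (λ v → 1 + U * c v w) * ∑ fs (stabs w)              ≡⟨ cong₂ _*_ factor (∑-stabs n w∈) ⟩
      (T * V + U * (T * s)) ^ suc n ∎
      where
      open ≡-Reasoning
      fs = choices (replicate n Ω)
      factor : ∑ Ω (λ v → 1 + U * c v w) ≡ T * V + U * (T * s)
      factor = trans (∑-+ Ω _ _) (cong₂ _+_ (trans (sym (length≡∑1 Ω)) |Ω|)
                 (trans (∑-*ˡ Ω U _) (cong (U *_) (∑-stab w∈))))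

    stab-weight : ∀ {n} w (f : Vec B n) (S : Subset n) →
      (∀ {i} → i ∈ S → c (lookup f i) w ≡ 1) → U ^ ∣ S ∣ ≤ stabs w f
    stab-weight w []      []          h = ≤-refl
    stab-weight w (v ∷ f) (false ∷ S) h =
      ≤-trans (stab-weight w f S (λ i∈ → h (there i∈))) (m≤m+n _ _)
    stab-weight w (v ∷ f) (true ∷ S) h =
      *-mono-≤ (≤-trans (≤-reflexive (trans (sym (*-identityʳ U)) (cong (U *_) (sym (h here))))) (n≤1+n _))
               (stab-weight w f S (λ i∈ → h (there i∈)))

  -- First moment method: averaged over all samples, the stabbing weights summed over the points are
  -- at most `A₁`, and the packing weight is at most `A₂`.
  good-sample : ∀ n U W r A₁ A₂ {{_ : NonZero A₁}} {{_ : NonZero A₂}} {{_ : NonZero V}} →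
    V * (T * V + U * (T * s)) ^ n ≤ A₁ * (T * V) ^ n →
    T * V < r * (b * s) → (V * (T + 3 * W)) ^ n * T ^ r ≤ A₂ * (T * V) ^ n →
    ∃ λ f → f ∈ˡ choices (replicate n Ω)
          × (∀ w → w ∈ˡ Π → stabs U w f ≤ 2 * A₁)
          × packings W (λ _ → true) f ≤ 2 * A₂
  good-sample n U W r A₁ A₂ h₁ hr h₂ =
    let f , f∈ , g≤ = term≤average fs g (A₂ * (2 * A₁)) nonempty ∑g≤
    in f , f∈
     , (λ w w∈ → ≤-trans (term≤∑ (λ w → stabs U w f) w∈)
                   (*-cancelˡ-≤ A₂ (≤-trans (m≤m+n _ _) g≤)))
     , *-cancelˡ-≤ A₁ (≤-trans (≤-trans (m≤n+m _ _) g≤) (≤-reflexive (rotate A₂ 2 A₁)))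
    where
    open ≤-Reasoning
    fs = choices (replicate n Ω)
    clq ind g : Vec B n → ℕ
    clq f = ∑ Π (λ w → stabs U w f)
    ind f = packings W (λ _ → true) f
    -- With these coefficients both terms average at most `A₁ * A₂`, so one sample with `g f` at
    -- most `2 * A₁ * A₂` serves both bounds.
    g f = A₂ * clq f + A₁ * ind f
    rotate : ∀ p q r → p * (q * r) ≡ r * (q * p)
    rotate = solve-∀
    |fs| : length fs ≡ (T * V) ^ n
    |fs| = trans (length-choices-replicate Ω n) (cong (_^ n) |Ω|)
    nonempty : 0 < length fs
    nonempty = subst (0 <_) (sym |fs|) (m^n>0 (T * V) {{m*n≢0 T V}} n)
    ∑clq : ∑ fs clq ≡ V * (T * V + U * (T * s)) ^ n
    ∑clq = trans (∑-swap fs Π _) (trans (∑-cong-∈ Π λ w∈ → ∑-stabs U n w∈)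
             (trans (∑-const Π _) (cong (_* (T * V + U * (T * s)) ^ n) |Π|)))
    size-all : size (λ _ → true) < r * (b * s)
    size-all = subst (_< r * (b * s)) (trans (sym |Ω|) (length≡∑1 Ω)) hr
    collect : ∀ A₁ A₂ N → A₂ * (A₁ * N) + A₁ * (A₂ * N) ≡ A₂ * (2 * A₁) * N
    collect = solve-∀
    ∑g≤ : ∑ fs g ≤ A₂ * (2 * A₁) * length fs
    ∑g≤ = begin
      ∑ fs g                                         ≡⟨ ∑-+ fs _ _ ⟩
      ∑ fs (λ f → A₂ * clq f) + ∑ fs (λ f → A₁ * ind f) ≡⟨ cong₂ _+_ (∑-*ˡ fs A₂ clq) (∑-*ˡ fs A₁ ind) ⟩
      A₂ * ∑ fs clq + A₁ * ∑ fs ind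
        ≤⟨ +-mono-≤ (*-monoʳ-≤ A₂ (≤-trans (≤-reflexive ∑clq) h₁))
                    (*-monoʳ-≤ A₁ (≤-trans (∑packings≤ W n r (λ _ → true) size-all) h₂)) ⟩
      A₂ * (A₁ * (T * V) ^ n) + A₁ * (A₂ * (T * V) ^ n) ≡⟨ collect A₁ A₂ _ ⟩
      A₂ * (2 * A₁) * (T * V) ^ n                    ≡⟨ cong (A₂ * (2 * A₁) *_) |fs| ⟨
      A₂ * (2 * A₁) * length fs ∎

-- Grids and their cells

≡ᵇ-refl : ∀ n → (n ≡ᵇ n) ≡ true
≡ᵇ-refl zero    = refl
≡ᵇ-refl (suc n) = ≡ᵇ-refl n

≢⇒≡ᵇ-false : ∀ {m n} → m ≢ n → (m ≡ᵇ n) ≡ false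
≢⇒≡ᵇ-false {m} {n} m≢n with m ≡ᵇ n in eq
... | false = refl
... | true  = contradiction (≡ᵇ⇒≡ m n (subst IsTrue (sym eq) tt)) m≢n

∑-upTo-suc : ∀ n f → ∑ (upTo (suc n)) f ≡ ∑ (upTo n) f + f n
∑-upTo-suc n f = trans (cong (λ xs → ∑ xs f) (sym (upTo-∷ʳ n)))
  (trans (∑-++ (upTo n) (n ∷ []) f) (cong (∑ (upTo n) f +_) (+-identityʳ (f n))))

∑-upTo-+ : ∀ m n f → ∑ (upTo (m + n)) f ≡ ∑ (upTo m) f + ∑ (upTo n) (λ i → f (m + i))
∑-upTo-+ m zero    f = trans (cong (λ k → ∑ (upTo k) f) (+-identityʳ m)) (sym (+-identityʳ _))
∑-upTo-+ m (suc n) f = begin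
  ∑ (upTo (m + suc n)) f                                               ≡⟨ cong (λ k → ∑ (upTo k) f) (+-suc m n) ⟩
  ∑ (upTo (suc (m + n))) f                                             ≡⟨ ∑-upTo-suc (m + n) f ⟩
  ∑ (upTo (m + n)) f + f (m + n)                                       ≡⟨ cong (_+ f (m + n)) (∑-upTo-+ m n f) ⟩
  ∑ (upTo m) f + ∑ (upTo n) (λ i → f (m + i)) + f (m + n)              ≡⟨ +-assoc (∑ (upTo m) f) _ _ ⟩
  ∑ (upTo m) f + (∑ (upTo n) (λ i → f (m + i)) + f (m + n))            ≡⟨ cong (∑ (upTo m) f +_) (∑-upTo-suc n _) ⟨
  ∑ (upTo m) f + ∑ (upTo (suc n)) (λ i → f (m + i)) ∎
  where open ≡-Reasoning

-- The range splits into `r` blocks of length `s`, on each of which `w / s` is constant.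
∑-upTo-/ : ∀ r s {{_ : NonZero s}} (g : ℕ → ℕ) → ∑ (upTo (r * s)) (λ w → g (w / s)) ≡ s * ∑ (upTo r) g
∑-upTo-/ zero    s g = sym (*-zeroʳ s)
∑-upTo-/ (suc r) s g = begin
  ∑ (upTo (s + r * s)) (λ w → g (w / s))                                         ≡⟨ cong (λ k → ∑ (upTo k) (λ w → g (w / s))) (+-comm s (r * s)) ⟩
  ∑ (upTo (r * s + s)) (λ w → g (w / s))                                         ≡⟨ ∑-upTo-+ (r * s) s _ ⟩
  ∑ (upTo (r * s)) (λ w → g (w / s)) + ∑ (upTo s) (λ i → g ((r * s + i) / s))    ≡⟨ cong₂ _+_ (∑-upTo-/ r s g) block ⟩
  s * ∑ (upTo r) g + s * g r                                                     ≡⟨ *-distribˡ-+ s (∑ (upTo r) g) (g r) ⟨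
  s * (∑ (upTo r) g + g r)                                                       ≡⟨ cong (s *_) (∑-upTo-suc r g) ⟨
  s * ∑ (upTo (suc r)) g ∎
  where
  open ≡-Reasoning
  quotient : ∀ {i} → i < s → (r * s + i) / s ≡ r
  quotient {i} i<s = trans (+-distrib-/-∣ˡ i (divides r refl))
    (trans (cong₂ _+_ (m*n/n≡m r s) (m<n⇒m/n≡0 i<s)) (+-identityʳ r))
  block : ∑ (upTo s) (λ i → g ((r * s + i) / s)) ≡ s * g r
  block = trans (∑-cong-∈ (upTo s) (λ i∈ → cong g (quotient (∈-upTo⁻ i∈))))
            (trans (∑-const (upTo s) (g r)) (cong (_* g r) (length-upTo s)))

∑-upTo-≡ᵇ : ∀ {q} r → q < r → ∑ (upTo r) (λ p → ⟦ q ≡ᵇ p ⟧) ≡ 1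
∑-upTo-≡ᵇ {q} (suc r) q<1+r with m≤n⇒m<n∨m≡n (≤-pred q<1+r)
... | inj₁ q<r = trans (∑-upTo-suc r _)
  (cong₂ _+_ (∑-upTo-≡ᵇ r q<r) (cong ⟦_⟧ (≢⇒≡ᵇ-false (<⇒≢ q<r))))
... | inj₂ refl = trans (∑-upTo-suc q _) (cong₂ _+_
  (trans (∑-cong-∈ (upTo q) λ p∈ → cong ⟦_⟧ (≢⇒≡ᵇ-false (≢-sym (<⇒≢ (∈-upTo⁻ p∈)))))
    (trans (∑-const (upTo q) 0) (*-zeroʳ (length (upTo q)))))
  (cong ⟦_⟧ (≡ᵇ-refl q)))

∑-upTo-block : ∀ s {{_ : NonZero s}} {R z} → s ∣ R → z < R →
  ∑ (upTo R) (λ w → ⟦ z / s ≡ᵇ w / s ⟧) ≡ s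
∑-upTo-block s (divides r refl) z<R =
  trans (∑-upTo-/ r s _) (trans (cong (s *_) (∑-upTo-≡ᵇ r (m<n*o⇒m/o<n z<R))) (*-identityʳ s))

≡ᵇ-sym : ∀ m n → (m ≡ᵇ n) ≡ (n ≡ᵇ m)
≡ᵇ-sym zero    zero    = refl
≡ᵇ-sym zero    (suc n) = refl
≡ᵇ-sym (suc m) zero    = refl
≡ᵇ-sym (suc m) (suc n) = ≡ᵇ-sym m n

grid : ∀ {d} → Vec ℕ d → List (Vec ℕ d)
grid R = choices (Vec.map upTo R)

∑-grid-* : ∀ {d} r (R : Vec ℕ d) (f : ℕ → ℕ) (g : Vec ℕ d → ℕ) (h : Vec ℕ (suc d) → ℕ) →
  (∀ a w → h (a ∷ w) ≡ f a * g w) → ∑ (grid (r ∷ R)) h ≡ ∑ (upTo r) f * ∑ (grid R) g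
∑-grid-* r R f g h h≡ = begin
  ∑ (grid (r ∷ R)) h                              ≡⟨ ∑-choices (upTo r) (Vec.map upTo R) h ⟩
  ∑ (upTo r) (λ a → ∑ (grid R) (λ w → h (a ∷ w))) ≡⟨ ∑-cong (upTo r) (λ a → trans (∑-cong (grid R) (h≡ a)) (∑-*ˡ (grid R) (f a) g)) ⟩
  ∑ (upTo r) (λ a → f a * ∑ (grid R) g)           ≡⟨ ∑-*ʳ (upTo r) _ f ⟩
  ∑ (upTo r) f * ∑ (grid R) g ∎
  where open ≡-Reasoning

∈-grid⁻ : ∀ {d} (R : Vec ℕ d) {w} → w ∈ˡ grid R → ∀ i → lookup w i < lookup R i
∈-grid⁻ R w∈ i = ∈-upTo⁻ (subst (_ ∈ˡ_) (lookup-map i upTo R) (lookup-∈-choices (Vec.map upTo R) w∈ i))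

^-monoʳ-∣ : ∀ b {x y} → x ≤ y → b ^ x ∣ b ^ y
^-monoʳ-∣ b {x} {y} x≤y = divides (b ^ (y ∸ x))
  (trans (cong (b ^_) (sym (m∸n+n≡m x≤y))) (^-distribˡ-+-* b (y ∸ x) x))

module Cells (b : ℕ) {{_ : NonZero b}} where

  infixl 7 _//_

  _//_ : ℕ → ℕ → ℕ
  z // x = (z / b ^ x) {{m^n≢0 b x}}

  -- The indicator of the aligned box with sides `b ^ xᵢ` around `z`. As a product of numbers it
  -- makes sums over the grid factor along the axes.
  cell : ∀ {d} → Vec ℕ d → Vec ℕ d → Vec ℕ d → ℕ
  cell []       []       []       = 1
  cell (x ∷ xs) (z ∷ zs) (w ∷ ws) = ⟦ z // x ≡ᵇ w // x ⟧ * cell xs zs ws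

  cell-sym : ∀ {d} (x z w : Vec ℕ d) → cell x z w ≡ cell x w z
  cell-sym []       []       []       = refl
  cell-sym (x ∷ xs) (z ∷ zs) (w ∷ ws) = cong₂ _*_ (cong ⟦_⟧ (≡ᵇ-sym (z // x) _)) (cell-sym xs zs ws)

  cell-size : ∀ {d} (x R z : Vec ℕ d) → (∀ i → b ^ lookup x i ∣ lookup R i) →
    (∀ i → lookup z i < lookup R i) → ∑ (grid R) (cell x z) ≡ b ^ sum x
  cell-size []       []      []       x∣R z<R = refl
  cell-size (x ∷ xs) (r ∷ R) (z ∷ zs) x∣R z<R =
    trans (∑-grid-* r R (λ a → ⟦ z // x ≡ᵇ a // x ⟧) (cell xs zs) _ (λ _ _ → refl))
      (trans (cong₂ _*_ (∑-upTo-block (b ^ x) {{m^n≢0 b x}} (x∣R zero) (z<R zero))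
                        (cell-size xs R zs (λ i → x∣R (suc i)) (λ i → z<R (suc i))))
        (sym (^-distribˡ-+-* b x (sum xs))))

  -- The count is a product over the axes, and along each axis the overlap lies within the shorter
  -- of the two intervals.
  common-cells : ∀ {d} (x y R z w : Vec ℕ d) →
    (∀ i → b ^ lookup x i ∣ lookup R i) → (∀ i → b ^ lookup y i ∣ lookup R i) →
    (∀ i → lookup z i < lookup R i) → (∀ i → lookup w i < lookup R i) →
    ∑ (grid R) (λ t → cell x z t * cell y w t) ≤ b ^ sum (zipWith _⊓_ x y)
  common-cells []       []       []      []       []       _ _ _ _ = ≤-refl
  common-cells (x ∷ xs) (y ∷ ys) (r ∷ R) (z ∷ zs) (w ∷ ws) x∣R y∣R z<R w<R = begin
    ∑ (grid (r ∷ R)) (λ t → cell (x ∷ xs) (z ∷ zs) t * cell (y ∷ ys) (w ∷ ws) t)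
      ≡⟨ ∑-grid-* r R (λ a → f a * g a) (λ t → cell xs zs t * cell ys ws t) _ (λ a t → *-interchange (f a) (cell xs zs t) (g a) (cell ys ws t)) ⟩
    ∑ (upTo r) (λ a → f a * g a) * ∑ (grid R) (λ t → cell xs zs t * cell ys ws t)
      ≤⟨ *-mono-≤ one (common-cells xs ys R zs ws (λ i → x∣R (suc i)) (λ i → y∣R (suc i)) (λ i → z<R (suc i)) (λ i → w<R (suc i))) ⟩
    b ^ (x ⊓ y) * b ^ sum (zipWith _⊓_ xs ys)
      ≡⟨ ^-distribˡ-+-* b (x ⊓ y) _ ⟨
    b ^ sum (zipWith _⊓_ (x ∷ xs) (y ∷ ys)) ∎
    where
    open ≤-Reasoning
    f g : ℕ → ℕ
    f a = ⟦ z // x ≡ᵇ a // x ⟧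
    g a = ⟦ w // y ≡ᵇ a // y ⟧
    one : ∑ (upTo r) (λ a → f a * g a) ≤ b ^ (x ⊓ y)
    one with ⊓-sel x y
    ... | inj₁ eq = ≤-trans (∑-mono (upTo r) λ a → ≤-trans (*-monoʳ-≤ (f a) (⟦⟧≤1 (w // y ≡ᵇ a // y))) (≤-reflexive (*-identityʳ (f a))))
                      (≤-reflexive (trans (∑-upTo-block (b ^ x) {{m^n≢0 b x}} (x∣R zero) (z<R zero)) (cong (b ^_) (sym eq))))
    ... | inj₂ eq = ≤-trans (∑-mono (upTo r) λ a → ≤-trans (*-monoˡ-≤ (g a) (⟦⟧≤1 (z // x ≡ᵇ a // x))) (≤-reflexive (*-identityˡ (g a))))
                      (≤-reflexive (trans (∑-upTo-block (b ^ y) {{m^n≢0 b y}} (y∣R zero) (w<R zero)) (cong (b ^_) (sym eq))))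

  ≡ᵇ-trans-≤ : ∀ p q a → ⟦ p ≡ᵇ a ⟧ * ⟦ q ≡ᵇ a ⟧ ≤ ⟦ p ≡ᵇ q ⟧ * ⟦ p ≡ᵇ a ⟧
  ≡ᵇ-trans-≤ p q a with p ≟ a | q ≟ a
  ... | yes refl | yes refl = ≤-refl
  ... | yes refl | no q≢a rewrite ≢⇒≡ᵇ-false q≢a = ≤-trans (≤-reflexive (*-zeroʳ ⟦ p ≡ᵇ p ⟧)) z≤n
  ... | no p≢a   | _      rewrite ≢⇒≡ᵇ-false p≢a = z≤n

  -- Cells of one shape coincide or are disjoint. In this form `cell x z w` can be pulled out of a
  -- sum over `t`.
  cell-trans-≤ : ∀ {d} (x z w t : Vec ℕ d) → cell x z t * cell x w t ≤ cell x z w * cell x z t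
  cell-trans-≤ []       []       []       []       = ≤-refl
  cell-trans-≤ (x ∷ xs) (z ∷ zs) (w ∷ ws) (t ∷ ts) = begin
    p * cell xs zs ts * (q * cell xs ws ts)      ≡⟨ *-interchange p _ q _ ⟩
    p * q * (cell xs zs ts * cell xs ws ts)      ≤⟨ *-mono-≤ (≡ᵇ-trans-≤ (z // x) (w // x) (t // x)) (cell-trans-≤ xs zs ws ts) ⟩
    r * p * (cell xs zs ws * cell xs zs ts)      ≡⟨ *-interchange r p _ _ ⟩
    r * cell xs zs ws * (p * cell xs zs ts) ∎
    where
    open ≤-Reasoning
    p = ⟦ z // x ≡ᵇ t // x ⟧
    q = ⟦ w // x ≡ᵇ t // x ⟧
    r = ⟦ z // x ≡ᵇ w // x ⟧

  cell⇒≡ : ∀ {d} (x z w : Vec ℕ d) → 0 < cell x z w →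
    ∀ i → lookup z i // lookup x i ≡ lookup w i // lookup x i
  cell⇒≡ (x ∷ xs) (z ∷ zs) (w ∷ ws) h i with z // x ≡ᵇ w // x in eq
  cell⇒≡ (x ∷ xs) (z ∷ zs) (w ∷ ws) h zero    | true = ≡ᵇ⇒≡ _ _ (subst IsTrue (sym eq) tt)
  cell⇒≡ (x ∷ xs) (z ∷ zs) (w ∷ ws) h (suc i) | true = cell⇒≡ xs zs ws (subst (0 <_) (*-identityˡ _) h) i

  ≡⇒cell : ∀ {d} (x z w : Vec ℕ d) →
    (∀ i → lookup z i // lookup x i ≡ lookup w i // lookup x i) → cell x z w ≡ 1
  ≡⇒cell []       []       []       h = refl
  ≡⇒cell (x ∷ xs) (z ∷ zs) (w ∷ ws) h =
    cong₂ _*_ (cong ⟦_⟧ (trans (cong (_≡ᵇ w // x) (h zero)) (≡ᵇ-refl (w // x))))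
              (≡⇒cell xs zs ws λ i → h (suc i))

  -- Shapes of equal volume and their overlaps

  module Shapes (e k ℓ : ℕ) where

    s : ℕ
    s = b ^ (e * k)

    -- The first exponent brings the total to `e * k`, so every cell has volume `s`. The truncated
    -- subtraction is exact, since the entries of a shape are below `k`.
    exponents : Vec ℕ e → Vec ℕ (suc e)
    exponents x = e * k ∸ sum x ∷ x

    -- Every side of a cell divides the range of its axis, so each shape tiles the `ℓ * s * s` grid
    -- points by `ℓ * s` cells.
    ranges : Vec ℕ (suc e)
    ranges = ℓ * s ∷ replicate e (b ^ k)

    shapes : List (Vec ℕ e)
    shapes = grid (replicate e k)

    -- (x , z) stands for the cell of shape x containing z, so that every cell occurs s times in items.
    Item : Set
    Item = Vec ℕ e × Vec ℕ (suc e)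

    items : List Item
    items = cartesianProduct shapes (grid ranges)

    contains : Item → Vec ℕ (suc e) → ℕ
    contains (x , z) w = cell (exponents x) z w

    eqv : ∀ {d} → Vec ℕ d → Vec ℕ d → ℕ
    eqv []       []       = 1
    eqv (x ∷ xs) (y ∷ ys) = ⟦ x ≡ᵇ y ⟧ * eqv xs ys

    same : Item → Item → ℕ
    same (x , z) (y , w) = eqv x y * cell (exponents x) z w

    eqv-refl : ∀ {d} (x : Vec ℕ d) → eqv x x ≡ 1
    eqv-refl []       = refl
    eqv-refl (x ∷ xs) = cong₂ _*_ (cong ⟦_⟧ (≡ᵇ-refl x)) (eqv-refl xs)

    ∑-eqv : ∀ {d} (x R : Vec ℕ d) → (∀ i → lookup x i < lookup R i) → ∑ (grid R) (eqv x) ≡ 1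
    ∑-eqv []       []      h = refl
    ∑-eqv (x ∷ xs) (r ∷ R) h =
      trans (∑-grid-* r R (λ a → ⟦ x ≡ᵇ a ⟧) (eqv xs) _ (λ _ _ → refl))
            (cong₂ _*_ (∑-upTo-≡ᵇ r (h zero)) (∑-eqv xs R λ i → h (suc i)))

    shape< : ∀ {x} → x ∈ˡ shapes → ∀ i → lookup x i < k
    shape< x∈ i = subst (_ <_) (lookup-replicate i k) (∈-grid⁻ (replicate e k) x∈ i)

    sum-≤ : ∀ {d} (x : Vec ℕ d) → (∀ i → lookup x i < k) → sum x ≤ d * k
    sum-≤ []       h = z≤n
    sum-≤ (x ∷ xs) h = +-mono-≤ (<⇒≤ (h zero)) (sum-≤ xs λ i → h (suc i))

    sum-exponents : ∀ {x} → x ∈ˡ shapes → sum (exponents x) ≡ e * k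
    sum-exponents {x} x∈ = m∸n+n≡m (sum-≤ x (shape< x∈))

    exponents∣ranges : ∀ {x} → x ∈ˡ shapes → ∀ i → b ^ lookup (exponents x) i ∣ lookup ranges i
    exponents∣ranges {x} x∈ zero    = ∣n⇒∣m*n ℓ (^-monoʳ-∣ b (m∸n≤m (e * k) (sum x)))
    exponents∣ranges {x} x∈ (suc i) = subst (b ^ lookup x i ∣_) (sym (lookup-replicate i (b ^ k)))
      (^-monoʳ-∣ b (<⇒≤ (shape< x∈ i)))

    items⁻ : ∀ {v} → v ∈ˡ items → proj₁ v ∈ˡ shapes × proj₂ v ∈ˡ grid ranges
    items⁻ = ∈-cartesianProduct⁻ shapes (grid ranges)

    length-grid : ∀ {d} (R : Vec ℕ d) → length (grid R) ≡ Vec.foldr (λ _ → ℕ) _*_ 1 R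
    length-grid [] = refl
    length-grid (r ∷ R) = trans (length≡∑1 (grid (r ∷ R)))
      (trans (∑-grid-* r R (λ _ → 1) (λ _ → 1) (λ _ → 1) (λ _ _ → refl))
        (cong₂ _*_ (trans (sym (length≡∑1 (upTo r))) (length-upTo r))
          (trans (sym (length≡∑1 (grid R))) (length-grid R))))

    product-replicate : ∀ d a → Vec.foldr (λ _ → ℕ) _*_ 1 (replicate d a) ≡ a ^ d
    product-replicate zero    a = refl
    product-replicate (suc d) a = cong (a *_) (product-replicate d a)

    length-shapes : length shapes ≡ k ^ e
    length-shapes = trans (length-grid (replicate e k)) (product-replicate e k)

    length-ranges : length (grid ranges) ≡ ℓ * s * s
    length-ranges = trans (length-grid ranges) (cong (ℓ * s *_)
      (trans (product-replicate e (b ^ k)) (trans (^-*-assoc b k e) (cong (b ^_) (*-comm k e)))))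

    ∑-items : (f : Item → ℕ) → ∑ items f ≡ ∑ shapes (λ x → ∑ (grid ranges) (λ z → f (x , z)))
    ∑-items = ∑-cartesianProductWith _,_ shapes (grid ranges)

    length-items : length items ≡ k ^ e * (ℓ * s * s)
    length-items = begin
      length items                                       ≡⟨ length≡∑1 items ⟩
      ∑ items (λ _ → 1)                                  ≡⟨ ∑-items _ ⟩
      ∑ shapes (λ _ → ∑ (grid ranges) (λ _ → 1))         ≡⟨ ∑-const shapes _ ⟩
      length shapes * ∑ (grid ranges) (λ _ → 1)          ≡⟨ cong₂ _*_ length-shapes (trans (sym (length≡∑1 (grid ranges))) length-ranges) ⟩
      k ^ e * (ℓ * s * s) ∎
      where open ≡-Reasoning

    ∑-cell : ∀ {v} → v ∈ˡ items → ∑ (grid ranges) (contains v) ≡ s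
    ∑-cell {x , z} v∈ = let x∈ , z∈ = items⁻ v∈ in
      trans (cell-size (exponents x) ranges z (exponents∣ranges x∈) (∈-grid⁻ ranges z∈))
            (cong (b ^_) (sum-exponents x∈))

    -- Each of the `k ^ e` shapes has one cell through `w`, listed once for each of its `s` points.
    ∑-stab : ∀ {w} → w ∈ˡ grid ranges → ∑ items (λ v → contains v w) ≡ k ^ e * s
    ∑-stab {w} w∈ = begin
      ∑ items (λ v → contains v w)                                     ≡⟨ ∑-items _ ⟩
      ∑ shapes (λ x → ∑ (grid ranges) (λ z → cell (exponents x) z w))  ≡⟨ ∑-cong-∈ shapes inner ⟩
      ∑ shapes (λ _ → s)                                               ≡⟨ trans (∑-const shapes s) (cong (_* s) length-shapes) ⟩
      k ^ e * s ∎
      where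
      open ≡-Reasoning
      inner : ∀ {x} → x ∈ˡ shapes → ∑ (grid ranges) (λ z → cell (exponents x) z w) ≡ s
      inner {x} x∈ = trans (∑-cong (grid ranges) λ z → cell-sym (exponents x) z w)
        (trans (cell-size (exponents x) ranges w (exponents∣ranges x∈) (∈-grid⁻ ranges w∈))
               (cong (b ^_) (sum-exponents x∈)))

    ∑-same : ∀ {v} → v ∈ˡ items → ∑ items (same v) ≤ s
    ∑-same {x , z} v∈ = ≤-reflexive (begin
      ∑ items (same (x , z))                                                        ≡⟨ ∑-items _ ⟩
      ∑ shapes (λ y → ∑ (grid ranges) (λ w → eqv x y * cell (exponents x) z w))     ≡⟨ ∑-cong shapes (λ y → trans (∑-*ˡ (grid ranges) (eqv x y) _) (cong (eqv x y *_) (∑-cell v∈))) ⟩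
      ∑ shapes (λ y → eqv x y * s)                                                  ≡⟨ ∑-*ʳ shapes s (eqv x) ⟩
      ∑ shapes (eqv x) * s                                                          ≡⟨ cong (_* s) (∑-eqv x (replicate e k) (∈-grid⁻ (replicate e k) (proj₁ (items⁻ v∈)))) ⟩
      1 * s                                                                         ≡⟨ *-identityˡ s ⟩
      s ∎)
      where open ≡-Reasoning

    sum-⊓-≤ʳ : ∀ {d} (x y : Vec ℕ d) → sum (zipWith _⊓_ x y) ≤ sum y
    sum-⊓-≤ʳ []       []       = z≤n
    sum-⊓-≤ʳ (x ∷ xs) (y ∷ ys) = +-mono-≤ (m⊓n≤n x y) (sum-⊓-≤ʳ xs ys)

    sum-⊓-≤ˡ : ∀ {d} (x y : Vec ℕ d) → sum (zipWith _⊓_ x y) ≤ sum x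
    sum-⊓-≤ˡ []       []       = z≤n
    sum-⊓-≤ˡ (x ∷ xs) (y ∷ ys) = +-mono-≤ (m⊓n≤m x y) (sum-⊓-≤ˡ xs ys)

    -- At the first coordinate where the vectors differ, the minimum lies strictly below one of
    -- them.
    sum-⊓-< : ∀ {d} (x y : Vec ℕ d) → x ≢ y →
      sum (zipWith _⊓_ x y) < sum x ⊎ sum (zipWith _⊓_ x y) < sum y
    sum-⊓-< []       []       x≢y = contradiction refl x≢y
    sum-⊓-< (x ∷ xs) (y ∷ ys) x≢y with <-cmp x y
    ... | tri< x<y _ _ = inj₂ (+-mono-<-≤ (≤-<-trans (m⊓n≤m x y) x<y) (sum-⊓-≤ʳ xs ys))
    ... | tri> _ _ y<x = inj₁ (+-mono-<-≤ (≤-<-trans (m⊓n≤n x y) y<x) (sum-⊓-≤ˡ xs ys))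
    ... | tri≈ _ refl _ with sum-⊓-< xs ys (λ { refl → x≢y refl })
    ...   | inj₁ h = inj₁ (+-mono-≤-< (m⊓n≤m x x) h)
    ...   | inj₂ h = inj₂ (+-mono-≤-< (m⊓n≤n x x) h)

    -- Both exponent vectors have sum `e * k`, so a strict loss against either of them suffices. One
    -- lost unit is the factor `b` in `common≤`.
    common-exponents : ∀ {x y} → x ∈ˡ shapes → y ∈ˡ shapes → x ≢ y →
      sum (zipWith _⊓_ (exponents x) (exponents y)) < e * k
    common-exponents {x} {y} x∈ y∈ x≢y with sum-⊓-< x y x≢y
    ... | inj₁ h = <-≤-trans (+-mono-≤-< (m⊓n≤m (e * k ∸ sum x) (e * k ∸ sum y)) h) (≤-reflexive (sum-exponents x∈))
    ... | inj₂ h = <-≤-trans (+-mono-≤-< (m⊓n≤n (e * k ∸ sum x) (e * k ∸ sum y)) h) (≤-reflexive (sum-exponents y∈))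

    -- Cells of one shape share points only if they coincide, which the `same` term covers. Cells of
    -- different shapes share at most `b ^ (e * k - 1) = s / b` points.
    common≤ : ∀ {v u} → v ∈ˡ items → u ∈ˡ items →
      b * common (grid ranges) contains v u ≤
      b * s * same v u + s * ⟦ not (common (grid ranges) contains v u ≡ᵇ 0) ⟧
    common≤ {x , z} {y , w} v∈ u∈ with ≡-dec _≟_ x y
    ... | yes refl = ≤-trans (*-monoʳ-≤ b same-shape)
      (≤-trans (≤-reflexive (rearrange b s _)) (m≤m+n _ _))
      where
      open ≤-Reasoning
      rearrange : ∀ b s t → b * (t * s) ≡ b * s * t
      rearrange = solve-∀
      same-shape : common (grid ranges) contains (x , z) (x , w) ≤ same (x , z) (x , w) * s
      same-shape = begin
        common (grid ranges) contains (x , z) (x , w)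
          ≤⟨ ∑-mono (grid ranges) (cell-trans-≤ (exponents x) z w) ⟩
        ∑ (grid ranges) (λ t → cell (exponents x) z w * cell (exponents x) z t)
          ≡⟨ trans (∑-*ˡ (grid ranges) (cell (exponents x) z w) _) (cong (cell (exponents x) z w *_) (∑-cell v∈)) ⟩
        cell (exponents x) z w * s
          ≡⟨ cong (_* s) (trans (sym (*-identityˡ _)) (cong (_* cell (exponents x) z w) (sym (eqv-refl x)))) ⟩
        same (x , z) (x , w) * s ∎
    ... | no x≢y with common (grid ranges) contains (x , z) (y , w) in eq
    ...   | zero  = ≤-trans (≤-reflexive (*-zeroʳ b)) z≤n
    ...   | suc n = ≤-trans bound (≤-trans (≤-reflexive (sym (*-identityʳ s))) (m≤n+m _ (b * s * same (x , z) (y , w))))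
      where
      bound : b * suc n ≤ s
      bound = let x∈ , z∈ = items⁻ v∈ ; y∈ , w∈ = items⁻ u∈ in
        ≤-trans (*-monoʳ-≤ b (≤-trans (≤-reflexive (sym eq))
                  (common-cells (exponents x) (exponents y) ranges z w
                    (exponents∣ranges x∈) (exponents∣ranges y∈) (∈-grid⁻ ranges z∈) (∈-grid⁻ ranges w∈))))
                (^-monoʳ-≤ b (common-exponents x∈ y∈ x≢y))

-- Realising a sample by boxes

∈-grid⁺ : ∀ {d} (R w : Vec ℕ d) → (∀ i → lookup w i < lookup R i) → w ∈ˡ grid R
∈-grid⁺ []      []       h = here refl
∈-grid⁺ (r ∷ R) (w ∷ ws) h =
  ∈-cartesianProductWith⁺ _∷_ (∈-upTo⁺ (h zero)) (∈-grid⁺ R ws λ i → h (suc i))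

-- The empty set gets `0`, the least grid coordinate; hence the condition `0 < m` in `maximum-<`.
maximum : ∀ {n} → Subset n → (Fin n → ℕ) → ℕ
maximum []          g = 0
maximum (true ∷ S)  g = g zero ⊔ maximum S (λ i → g (suc i))
maximum (false ∷ S) g = maximum S (λ i → g (suc i))

≤-maximum : ∀ {n} (S : Subset n) g {i} → i ∈ S → g i ≤ maximum S g
≤-maximum (true ∷ S)  g here       = m≤m⊔n (g zero) _
≤-maximum (true ∷ S)  g (there i∈) = ≤-trans (≤-maximum S _ i∈) (m≤n⊔m (g zero) _)
≤-maximum (false ∷ S) g (there i∈) = ≤-maximum S _ i∈

maximum-< : ∀ {n} (S : Subset n) g {m} → 0 < m → (∀ {i} → i ∈ S → g i < m) → maximum S g < m
maximum-< []          g 0<m h = 0<m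
maximum-< (true ∷ S)  g 0<m h = ⊔-lub (h here) (maximum-< S _ 0<m λ i∈ → h (there i∈))
maximum-< (false ∷ S) g 0<m h = maximum-< S _ 0<m λ i∈ → h (there i∈)

/-unique : ∀ {w q} s {{_ : NonZero s}} → q * s ≤ w → w < q * s + s → w / s ≡ q
/-unique {w} {q} s q*s≤w w<q*s+s = ≤-antisym
  (≤-pred (m<n*o⇒m/o<n (subst (w <_) (+-comm (q * s) s) w<q*s+s)))
  (≤-trans (≤-reflexive (sym (m*n/n≡m q s))) (/-monoˡ-≤ s q*s≤w))

≤/*+∸1 : ∀ w s {{_ : NonZero s}} → w ≤ w / s * s + (s ∸ 1)
≤/*+∸1 w s = begin
  w                        ≡⟨ m≡m%n+[m/n]*n w s ⟩
  w % s + w / s * s        ≡⟨ +-comm (w % s) _ ⟩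
  w / s * s + w % s        ≤⟨ +-monoʳ-≤ (w / s * s) (<⇒≤pred (m%n<n w s)) ⟩
  w / s * s + (s ∸ 1) ∎
  where
  open ≤-Reasoning

module Realization (b e k ℓ : ℕ) {{_ : NonZero b}} {{_ : NonZero k}} where

  open Cells b
  open Shapes e k ℓ

  open Sample items (grid ranges) contains same (k ^ e) (ℓ * s * s) s b
    {{m^n≢0 k e}} {{m^n≢0 b (e * k)}} length-items length-ranges ∑-cell ∑-stab ∑-same common≤ public

  side low-end : Item → Fin (suc e) → ℕ
  side (x , z) t = b ^ lookup (exponents x) t
  low-end (x , z) t = lookup z t // lookup (exponents x) t * side (x , z) t

  side>0 : ∀ v t → 0 < side v t
  side>0 (x , z) t = m^n>0 b (lookup (exponents x) t)

  contains⇒bounds : ∀ v w → 0 < contains v w → ∀ t →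
    low-end v t ≤ lookup w t × lookup w t ≤ low-end v t + (side v t ∸ 1)
  contains⇒bounds (x , z) w h t rewrite cell⇒≡ (exponents x) z w h t =
    m/n*n≤m (lookup w t) (b ^ lookup (exponents x) t) {{m^n≢0 b (lookup (exponents x) t)}} ,
    ≤/*+∸1 (lookup w t) (b ^ lookup (exponents x) t) {{m^n≢0 b (lookup (exponents x) t)}}

  bounds⇒contains : ∀ v w → (∀ t → low-end v t ≤ lookup w t) →
    (∀ t → lookup w t < low-end v t + side v t) → contains v w ≡ 1
  bounds⇒contains (x , z) w lo≤ <hi = ≡⇒cell (exponents x) z w λ t →
    sym (/-unique (b ^ lookup (exponents x) t) {{m^n≢0 b (lookup (exponents x) t)}} (lo≤ t) (<hi t))

  module _ {n} {{_ : NonZero n}} (f : Vec Item n) (f∈ : f ∈ˡ choices (replicate n items)) where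

    -- The coordinates are scaled by n, and the i-th box is enlarged by i < n: this changes no
    -- intersection, but makes the boxes distinct even when the sample has repetitions.
    family : Family (suc e) n
    family i = box
      (λ t → pos (n * low-end (lookup f i) t))
      (λ t → pos (n * (low-end (lookup f i) t + (side (lookup f i) t ∸ 1)) + toℕ i))
      (λ t → +≤+ (≤-trans (*-monoʳ-≤ n (m≤m+n (low-end (lookup f i) t) _)) (m≤m+n _ (toℕ i))))

    -- The index is the residue modulo `n` of the upper end along the first axis.
    family-injective : Injective _≡_ _≡_ family
    family-injective {i} {j} eq = toℕ-injective (begin
      toℕ i                ≡⟨ residue i (high i) ⟨
      (n * high i + toℕ i) % n   ≡⟨ cong (_% n) (ℤ.+-injective (cong (λ B → hi B zero) eq)) ⟩
      (n * high j + toℕ j) % n   ≡⟨ residue j (high j) ⟩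
      toℕ j ∎)
      where
      open ≡-Reasoning
      high : Fin n → ℕ
      high i = low-end (lookup f i) zero + (side (lookup f i) zero ∸ 1)
      residue : ∀ i h → (n * h + toℕ i) % n ≡ toℕ i
      residue i h = trans (cong (_% n) (trans (+-comm (n * h) _) (cong (λ p → toℕ i + p) (*-comm n h))))
        (trans ([m+kn]%n≡m%n (toℕ i) h n) (m<n⇒m%n≡m (toℕ<n i)))

    item∈ : ∀ i → lookup f i ∈ˡ items
    item∈ i = subst (lookup f i ∈ˡ_) (lookup-replicate i items) (lookup-∈-choices (replicate n items) f∈ i)

    low-end<range : ∀ i t → low-end (lookup f i) t < lookup ranges t
    low-end<range i t = ≤-<-trans
      (m/n*n≤m (lookup z t) _ {{m^n≢0 b (lookup (exponents x) t)}})
      (∈-grid⁻ ranges (proj₂ (items⁻ (item∈ i))) t)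
      where
      x = proj₁ (lookup f i)
      z = proj₂ (lookup f i)

    -- An enlargement by less than `n`, one grid step after scaling, cannot reach the next grid
    -- coordinate.
    intersect⇒low-end< : ∀ i j → Intersect (family i) (family j) → ∀ t →
      low-end (lookup f i) t < low-end (lookup f j) t + side (lookup f j) t
    intersect⇒low-end< i j (p , p∈i , p∈j) t = *-cancelˡ-< n _ _ (begin-strict
      n * low-end (lookup f i) t                 ≤⟨ drop‿+≤+ (ℤ.≤-trans (proj₁ (p∈i t)) (proj₂ (p∈j t))) ⟩
      n * (a + (c ∸ 1)) + toℕ j                  <⟨ +-monoʳ-< (n * (a + (c ∸ 1))) (toℕ<n j) ⟩
      n * (a + (c ∸ 1)) + n                      ≡⟨ factor n a (c ∸ 1) ⟩
      n * (a + (1 + (c ∸ 1)))                    ≡⟨ cong (λ c → n * (a + c)) (m+[n∸m]≡n (side>0 (lookup f j) t)) ⟩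
      n * (a + c) ∎)
      where
      open ≤-Reasoning
      a = low-end (lookup f j) t
      c = side (lookup f j) t
      factor : ∀ n a c → n * (a + c) + n ≡ n * (a + (1 + c))
      factor = solve-∀

    -- Helly's theorem for boxes: the coordinatewise maximum of the lower ends lies in every box of
    -- the clique.
    clique-point : (S : Subset n) → IsClique family S →
      (∀ t → 0 < lookup ranges t) →
      ∃ λ w → w ∈ˡ grid ranges × (∀ {i} → i ∈ S → contains (lookup f i) w ≡ 1)
    clique-point S clique 0<R = w
      , ∈-grid⁺ ranges w (λ t → subst (_< lookup ranges t) (sym (w≡ t))
          (maximum-< S (ends t) (0<R t) (λ {i} _ → low-end<range i t)))
      , λ {j} j∈ → bounds⇒contains (lookup f j) w
          (λ t → subst (ends t j ≤_) (sym (w≡ t)) (≤-maximum S (ends t) j∈))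
          (λ t → subst (_< ends t j + side (lookup f j) t) (sym (w≡ t))
            (maximum-< S (ends t) (≤-trans (side>0 (lookup f j) t) (m≤n+m _ _)) (λ {i} i∈ → pairwise i j i∈ j∈ t)))
      where
      ends : Fin (suc e) → Fin n → ℕ
      ends t i = low-end (lookup f i) t
      w : Vec ℕ (suc e)
      w = tabulate λ t → maximum S (ends t)
      w≡ : ∀ t → lookup w t ≡ maximum S (ends t)
      w≡ t = lookup∘tabulate (λ t → maximum S (ends t)) t
      pairwise : ∀ i j → i ∈ S → j ∈ S → ∀ t → ends t i < ends t j + side (lookup f j) t
      -- A clique says nothing about `i = j`; there the positive side length suffices.
      pairwise i j i∈ j∈ t with i Fin.≟ j
      ... | yes refl = m<m+n (ends t i) (side>0 (lookup f i) t)
      ... | no i≢j   = intersect⇒low-end< i j (clique i j i∈ j∈ i≢j) t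

    common⇒intersect : ∀ i j → 0 < common (grid ranges) contains (lookup f i) (lookup f j) →
      Intersect (family i) (family j)
    common⇒intersect i j h with ∑>0⇒term>0 (grid ranges) _ h
    ... | w , _ , 0<p = (λ t → pos (n * lookup w t)) , inside i 0<i , inside j 0<j
      where
      0<i = >-nonZero⁻¹ _ {{m*n≢0⇒m≢0 (contains (lookup f i) w) {{>-nonZero 0<p}}}}
      0<j = >-nonZero⁻¹ _ {{m*n≢0⇒n≢0 (contains (lookup f i) w) {{>-nonZero 0<p}}}}
      inside : ∀ i → 0 < contains (lookup f i) w → (λ t → pos (n * lookup w t)) ∈Box family i
      inside i h t = let lo≤ , ≤hi = contains⇒bounds (lookup f i) w h t in
        +≤+ (*-monoʳ-≤ n lo≤) , +≤+ (≤-trans (*-monoʳ-≤ n ≤hi) (m≤m+n _ (toℕ i)))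

    independent⇒apart : (S : Subset n) → IsIndependent family S → ∀ {i j} → i ∈ S → j ∈ S → i ≢ j →
      meets (lookup f i) (lookup f j) ≡ false
    independent⇒apart S independent {i} {j} i∈ j∈ i≢j
      with common (grid ranges) contains (lookup f i) (lookup f j) in eq
    ... | zero  = refl
    ... | suc _ = contradiction (common⇒intersect i j (subst (0 <_) (sym eq) (s≤s z≤n))) (independent i j i∈ j∈ i≢j)

  -- Reduces the theorem to arithmetic. The first and third hypotheses bound the average clique and
  -- packing weights; the second says that fewer than `r` eliminations of `b * s` items are
  -- possible.
  box-family : ∀ n U W r A₁ A₂
    {{_ : NonZero n}} {{_ : NonZero A₁}} {{_ : NonZero A₂}} {{_ : NonZero ℓ}} →
    (ℓ * s * s) * (k ^ e * (ℓ * s * s) + U * (k ^ e * s)) ^ n ≤ A₁ * (k ^ e * (ℓ * s * s)) ^ n →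
    k ^ e * (ℓ * s * s) < r * (b * s) →
    (ℓ * s * s * (k ^ e + 3 * W)) ^ n * (k ^ e) ^ r ≤ A₂ * (k ^ e * (ℓ * s * s)) ^ n →
    Σ (Family (suc e) n) λ F → Injective _≡_ _≡_ F
      × ((S : Subset n) → IsClique F S → U ^ ∣ S ∣ ≤ 2 * A₁)
      × ((S : Subset n) → IsIndependent F S → W ^ ∣ S ∣ ≤ 2 * A₂)
  box-family n U W r A₁ A₂ h₁ hr h₂ =
    let f , f∈ , stabs≤ , packings≤ = good-sample n U W r A₁ A₂ h₁ hr h₂ in
    family f f∈
    , family-injective f f∈
    , (λ S clique → let w , w∈ , stabbed = clique-point f f∈ S clique ranges>0 in
        ≤-trans (stab-weight U w f S stabbed) (stabs≤ w w∈))
    , (λ S independent → ≤-trans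
        (packing-weight W (λ _ → true) f S (λ _ → refl) (independent⇒apart f f∈ S independent))
        packings≤)
    where
    instance
      s≢0 : NonZero s
      s≢0 = m^n≢0 b (e * k)
      ℓs≢0 : NonZero (ℓ * s)
      ℓs≢0 = m*n≢0 ℓ s
      ℓss≢0 : NonZero (ℓ * s * s)
      ℓss≢0 = m*n≢0 (ℓ * s) s
    ranges>0 : ∀ t → 0 < lookup ranges t
    ranges>0 zero    = >-nonZero⁻¹ (ℓ * s)
    ranges>0 (suc t) = subst (0 <_) (sym (lookup-replicate t (b ^ k))) (m^n>0 b k)

-- Estimates and the choice of parameters

^-distribʳ-* : ∀ m n o → (m * n) ^ o ≡ m ^ o * n ^ o
^-distribʳ-* m n zero    = refl
^-distribʳ-* m n (suc o) = trans (cong (m * n *_) (^-distribʳ-* m n o)) (*-interchange m n (m ^ o) (n ^ o))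

-- Bernoulli's inequality (1 - a/(c+a))^m ≥ 1 - ma/(c+a), with denominators cleared and t = c - ma.
bernoulli : ∀ a c m t → m * a + t ≡ c → (c + a) ^ m * (a + t) ≤ c ^ m * (c + a)
bernoulli a c zero    t refl = ≤-reflexive (cong (1 *_) (+-comm a t))
bernoulli a c (suc m) t eq   = begin
  (c + a) * (c + a) ^ m * (a + t)             ≡⟨ swap (c + a) ((c + a) ^ m) (a + t) ⟩
  (c + a) ^ m * ((c + a) * (a + t))           ≤⟨ *-monoʳ-≤ ((c + a) ^ m) step ⟩
  (c + a) ^ m * (c * (a + (a + t)))           ≡⟨ *-swapˡ ((c + a) ^ m) c _ ⟩
  c * ((c + a) ^ m * (a + (a + t)))           ≤⟨ *-monoʳ-≤ c (bernoulli a c m (a + t) eq′) ⟩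
  c * (c ^ m * (c + a))                       ≡⟨ *-assoc c (c ^ m) (c + a) ⟨
  c * c ^ m * (c + a) ∎
  where
  open ≤-Reasoning
  swap : ∀ p q r → p * q * r ≡ q * (p * r)
  swap = solve-∀
  assoc : ∀ m a t → m * a + (a + t) ≡ a + m * a + t
  assoc = solve-∀
  eq′ : m * a + (a + t) ≡ c
  eq′ = trans (assoc m a t) eq
  a+t≤c : a + t ≤ c
  a+t≤c = ≤-trans (m≤n+m (a + t) (m * a)) (≤-reflexive eq′)
  expandˡ : ∀ a c t → (c + a) * (a + t) ≡ c * (a + t) + a * (a + t)
  expandˡ = solve-∀
  expandʳ : ∀ a c t → c * (a + t) + a * c ≡ c * (a + (a + t))
  expandʳ = solve-∀
  step : (c + a) * (a + t) ≤ c * (a + (a + t))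
  step = begin
    (c + a) * (a + t)              ≡⟨ expandˡ a c t ⟩
    c * (a + t) + a * (a + t)      ≤⟨ +-monoʳ-≤ (c * (a + t)) (*-monoʳ-≤ a a+t≤c) ⟩
    c * (a + t) + a * c            ≡⟨ expandʳ a c t ⟩
    c * (a + (a + t)) ∎

-- An integral form of `(1 + a/c)^c ≤ 4^a`. The exponent is cut into `2 * a` pieces of length
-- `g = c / (2 * a)`; since `g * a = c / 2`, Bernoulli bounds each piece by `2`.
[c+a]^c≤ : ∀ a c {{_ : NonZero a}} → 2 * a ∣ c → (c + a) ^ c ≤ 2 ^ (2 * a) * c ^ c
[c+a]^c≤ a c (divides g c≡) = begin
  (c + a) ^ c                          ≡⟨ cong ((c + a) ^_) c≡ ⟩
  (c + a) ^ (g * (2 * a))              ≡⟨ ^-*-assoc (c + a) g (2 * a) ⟨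
  ((c + a) ^ g) ^ (2 * a)              ≤⟨ ^-monoˡ-≤ (2 * a) half ⟩
  (2 * c ^ g) ^ (2 * a)                ≡⟨ ^-distribʳ-* 2 (c ^ g) (2 * a) ⟩
  2 ^ (2 * a) * (c ^ g) ^ (2 * a)      ≡⟨ cong (2 ^ (2 * a) *_) (trans (^-*-assoc c g (2 * a)) (cong (c ^_) (sym c≡))) ⟩
  2 ^ (2 * a) * c ^ c ∎
  where
  open ≤-Reasoning
  double : ∀ g a → g * a + g * a ≡ g * (2 * a)
  double = solve-∀
  c+a≤ : c + a ≤ 2 * (a + g * a)
  c+a≤ = ≤-trans (≤-reflexive (cong (_+ a) c≡)) (≤-trans (m≤m+n _ a) (≤-reflexive (ident g a)))
    where
    ident : ∀ g a → g * (2 * a) + a + a ≡ 2 * (a + g * a)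
    ident = solve-∀
  half : (c + a) ^ g ≤ 2 * c ^ g
  half = *-cancelʳ-≤ _ _ (a + g * a) {{>-nonZero (≤-trans (>-nonZero⁻¹ a) (m≤m+n a (g * a)))}} (begin
    (c + a) ^ g * (a + g * a)        ≤⟨ bernoulli a c g (g * a) (trans (double g a) (sym c≡)) ⟩
    c ^ g * (c + a)                  ≤⟨ *-monoʳ-≤ (c ^ g) c+a≤ ⟩
    c ^ g * (2 * (a + g * a))        ≡⟨ swap (c ^ g) (a + g * a) ⟩
    2 * c ^ g * (a + g * a) ∎)
    where
    swap : ∀ p q → p * (2 * q) ≡ 2 * p * q
    swap = solve-∀

-- Powers of `A / B ≥ 1` increase with the exponent. This carries bounds from `c`, which has the
-- required divisors, down to `n`.
^-ratio-mono : ∀ A B E {n c} {{_ : NonZero B}} → B ≤ A → n ≤ c → A ^ c ≤ E * B ^ c → A ^ n ≤ E * B ^ n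
^-ratio-mono A B E {n} B≤A n≤c h with t , refl ← m≤n⇒∃[o]m+o≡n n≤c =
  *-cancelʳ-≤ _ _ (B ^ t) {{m^n≢0 B t}} (begin
    A ^ n * B ^ t          ≤⟨ *-monoʳ-≤ (A ^ n) (^-monoˡ-≤ t B≤A) ⟩
    A ^ n * A ^ t          ≡⟨ ^-distribˡ-+-* A n t ⟨
    A ^ (n + t)            ≤⟨ h ⟩
    E * B ^ (n + t)        ≡⟨ trans (cong (E *_) (^-distribˡ-+-* B n t)) (sym (*-assoc E _ _)) ⟩
    E * B ^ n * B ^ t ∎)
  where open ≤-Reasoning

2^-cancel-≤ : ∀ {m n} → 2 ^ m ≤ 2 ^ n → m ≤ n
2^-cancel-≤ {m} {n} h with m ≤? n
... | yes m≤n = m≤n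
... | no m≰n  = contradiction (^-monoʳ-< 2 (s≤s (s≤s z≤n)) (≰⇒> m≰n)) (≤⇒≯ h)

n<2^n : ∀ n → n < 2 ^ n
n<2^n zero    = s≤s z≤n
n<2^n (suc n) = begin-strict
  suc n            <⟨ s≤s (n<2^n n) ⟩
  1 + 2 ^ n        ≤⟨ +-monoˡ-≤ (2 ^ n) (m^n>0 2 n) ⟩
  2 ^ n + 2 ^ n    ≡⟨ cong (2 ^ n +_) (+-identityʳ (2 ^ n)) ⟨
  2 ^ suc n ∎
  where open ≤-Reasoning

2^m≤n : ∀ m n → 0 < n → m ≤ ⌊log₂ n ⌋ → 2 ^ m ≤ n
2^m≤n zero    n             0<n h = 0<n
2^m≤n (suc m) (suc zero)    0<n ()
2^m≤n (suc m) n@(suc (suc _)) 0<n h = begin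
  2 ^ suc m          ≤⟨ *-monoʳ-≤ 2 (2^m≤n m ⌊ n /2⌋ (s≤s z≤n)
                          (≤-trans (∸-monoˡ-≤ 1 h) (≤-reflexive (sym (⌊log₂⌊n/2⌋⌋≡⌊log₂n⌋∸1 n))))) ⟩
  2 * ⌊ n /2⌋        ≡⟨ cong (⌊ n /2⌋ +_) (+-identityʳ _) ⟩
  ⌊ n /2⌋ + ⌊ n /2⌋  ≤⟨ +-monoʳ-≤ ⌊ n /2⌋ (⌊n/2⌋≤⌈n/2⌉ n) ⟩
  ⌊ n /2⌋ + ⌈ n /2⌉  ≡⟨ ⌊n/2⌋+⌈n/2⌉≡n n ⟩
  n ∎
  where
  open ≤-Reasoning

2^⌊log₂n⌋≤n : ∀ n → 0 < n → 2 ^ ⌊log₂ n ⌋ ≤ n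
2^⌊log₂n⌋≤n n 0<n = 2^m≤n ⌊log₂ n ⌋ n 0<n ≤-refl

n<2^[1+⌊log₂n⌋] : ∀ n → n < 2 ^ suc ⌊log₂ n ⌋
n<2^[1+⌊log₂n⌋] n = ≰⇒> λ h → <-irrefl refl
  (≤-trans (≤-reflexive (sym (⌊log₂[2^n]⌋≡n (suc ⌊log₂ n ⌋)))) (⌊log₂⌋-mono-≤ h))

-- `large` says exactly that the cell volume `s` is at most `n`, and `5 ≤ j` makes `32` divide `T`.
-- Each shape has `c` cells, where `ℓ` is chosen to give `n ≤ c ≤ 2 * n`.
module Construction (e′ j n : ℕ) (5≤j : 5 ≤ j) {{_ : NonZero n}}
  (large : 2 ^ (3 * (j * suc e′) * (suc e′ * 2 ^ j)) ≤ n) where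

  private
    e k T b s ℓ c : ℕ
    e = suc e′
    k = 2 ^ j
    T = k ^ e
    b = T * T * T
    instance
      k≢0 : NonZero k
      k≢0 = m^n≢0 2 j
      T≢0 : NonZero T
      T≢0 = m^n≢0 k e
      TT≢0 : NonZero (T * T)
      TT≢0 = m*n≢0 T T
      b≢0 : NonZero b
      b≢0 = m*n≢0 (T * T) T
      ek≢0 : NonZero (e * k)
      ek≢0 = m*n≢0 e k
    s = b ^ (e * k)
    instance
      s≢0 : NonZero s
      s≢0 = m^n≢0 b (e * k)
    ℓ = suc (n / s)
    c = ℓ * s
    instance
      c≢0 : NonZero c
      c≢0 = m*n≢0 ℓ s
      cs≢0 : NonZero (c * s)
      cs≢0 = m*n≢0 c s

    -- The exact quotients `q = c / b` and `c₁ = c / T`.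
    q c₁ : ℕ
    q = ℓ * b ^ pred (e * k)
    c₁ = q * T * T

    s≡ : s ≡ b * b ^ pred (e * k)
    s≡ = cong (b ^_) (sym (suc-pred (e * k)))

    c≡qb : c ≡ q * b
    c≡qb = trans (cong (ℓ *_) s≡) (rearrange ℓ b _)
      where
      rearrange : ∀ ℓ b p → ℓ * (b * p) ≡ ℓ * p * b
      rearrange = solve-∀

    c≡c₁T : c ≡ c₁ * T
    c≡c₁T = trans c≡qb (rearrange q T)
      where
      rearrange : ∀ q T → q * (T * T * T) ≡ q * T * T * T
      rearrange = solve-∀

    T≡ : T ≡ 2 ^ (j * e)
    T≡ = ^-*-assoc 2 j e

    32∣T : 32 ∣ T
    32∣T = subst (32 ∣_) (sym T≡) (^-monoʳ-∣ 2 {5} (≤-trans 5≤j (m≤m*n j e)))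

    2k∣c : 2 * k ∣ c
    2k∣c = ∣-trans (*-pres-∣ {2} {T} {k} {T} (∣-trans (divides {2} {32} 16 refl) 32∣T) (divides (k ^ e′) (*-comm k (k ^ e′))))
      (∣-trans (divides T (*-comm (T * T) T)) (divides q c≡qb))

    n≤c : n ≤ c
    n≤c = begin
      n                     ≡⟨ m≡m%n+[m/n]*n n s ⟩
      n % s + n / s * s     ≤⟨ +-monoˡ-≤ _ (<⇒≤ (m%n<n n s)) ⟩
      c ∎
      where open ≤-Reasoning

    s≤n : s ≤ n
    s≤n = ≤-trans (≤-reflexive s-exponent) large
      where
      s-exponent : s ≡ 2 ^ (3 * (j * e) * (e * k))
      s-exponent = trans (cong (_^ (e * k)) b-exponent) (^-*-assoc 2 (3 * (j * e)) (e * k))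
        where
        cube : ∀ p → p * p * p ≡ p * (p * (p * 1))
        cube = solve-∀
        b-exponent : b ≡ 2 ^ (3 * (j * e))
        b-exponent = trans (cong (λ p → p * p * p) T≡) (trans (cube (2 ^ (j * e)))
          (trans (^-*-assoc 2 (j * e) 3) (cong (2 ^_) (*-comm (j * e) 3))))

    c≤2n : c ≤ 2 * n
    c≤2n = ≤-trans (+-mono-≤ s≤n (m/n*n≤m n s)) (≤-reflexive (cong (n +_) (sym (+-identityʳ n))))

    -- `A₁` is the number `c * s` of points times `4 ^ k`, a bound for `(1 + k/c)^n`. `r` exceeds
    -- `T * c / b = T * q` by one because `hr` is strict. `A₂` combines a bound for `(1 + 12/T)^n`
    -- with the elimination budget `T ^ r`.
    A₁ A₂ r : ℕ
    A₁ = c * s * 2 ^ (2 * k)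
    r  = T * q + 1
    A₂ = 2 ^ (32 * c₁) * T ^ r

    instance
      A₁≢0 : NonZero A₁
      A₁≢0 = m*n≢0 (c * s) (2 ^ (2 * k)) {{m*n≢0 c s}} {{m^n≢0 2 (2 * k)}}
      A₂≢0 : NonZero A₂
      A₂≢0 = m*n≢0 (2 ^ (32 * c₁)) (T ^ r) {{m^n≢0 2 (32 * c₁)}} {{m^n≢0 T r}}

    h₁ : c * s * (T * (c * s) + k * (T * s)) ^ n ≤ A₁ * (T * (c * s)) ^ n
    h₁ = begin
      c * s * (T * (c * s) + k * (T * s)) ^ n            ≡⟨ cong (λ p → c * s * p ^ n) (factor T c s k) ⟩
      c * s * ((c + k) * (T * s)) ^ n                    ≡⟨ cong (c * s *_) (^-distribʳ-* (c + k) (T * s) n) ⟩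
      c * s * ((c + k) ^ n * (T * s) ^ n)                ≤⟨ *-monoʳ-≤ (c * s) (*-monoˡ-≤ ((T * s) ^ n)
                                                              (^-ratio-mono (c + k) c (2 ^ (2 * k)) (m≤m+n c k) n≤c ([c+a]^c≤ k c 2k∣c))) ⟩
      c * s * (2 ^ (2 * k) * c ^ n * (T * s) ^ n)        ≡⟨ assoc (c * s) (2 ^ (2 * k)) (c ^ n) ((T * s) ^ n) ⟩
      A₁ * (c ^ n * (T * s) ^ n)                         ≡⟨ cong (A₁ *_) (^-distribʳ-* c (T * s) n) ⟨
      A₁ * (c * (T * s)) ^ n                             ≡⟨ cong (λ p → A₁ * p ^ n) (*-swapˡ c T s) ⟩
      A₁ * (T * (c * s)) ^ n ∎
      where
      open ≤-Reasoning
      factor : ∀ T c s k → T * (c * s) + k * (T * s) ≡ (c + k) * (T * s)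
      factor = solve-∀
      assoc : ∀ p q r t → p * (q * r * t) ≡ p * q * (r * t)
      assoc = solve-∀

    hr : T * (c * s) < r * (b * s)
    hr = begin-strict
      T * (c * s)            ≡⟨ cong (λ p → T * (p * s)) c≡qb ⟩
      T * (q * b * s)        ≡⟨ assoc T q b s ⟩
      T * q * (b * s)        <⟨ *-monoˡ-< (b * s) {{m*n≢0 b s}} (m<m+n (T * q) (s≤s z≤n)) ⟩
      r * (b * s) ∎
      where
      open ≤-Reasoning
      assoc : ∀ T q b s → T * (q * b * s) ≡ T * q * (b * s)
      assoc = solve-∀

    -- Here `12 = 3 * W` with `W = 4`. It is rounded up to `16` so that `2 * 16` divides `T`, and
    -- the exponent is split as `c = T * c₁`.
    [T+12]^n≤ : (T + 12) ^ n ≤ 2 ^ (32 * c₁) * T ^ n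
    [T+12]^n≤ = ^-ratio-mono (T + 12) T (2 ^ (32 * c₁)) (m≤m+n T 12) n≤c (begin
      (T + 12) ^ c                        ≤⟨ ^-monoˡ-≤ c (+-monoʳ-≤ T (m≤m+n 12 4)) ⟩
      (T + 16) ^ c                        ≡⟨ trans (cong ((T + 16) ^_) c≡Tc₁) (sym (^-*-assoc (T + 16) T c₁)) ⟩
      ((T + 16) ^ T) ^ c₁                 ≤⟨ ^-monoˡ-≤ c₁ ([c+a]^c≤ 16 T 32∣T) ⟩
      (2 ^ 32 * T ^ T) ^ c₁               ≡⟨ ^-distribʳ-* (2 ^ 32) (T ^ T) c₁ ⟩
      (2 ^ 32) ^ c₁ * (T ^ T) ^ c₁        ≡⟨ cong₂ _*_ (^-*-assoc 2 32 c₁) (trans (^-*-assoc T T c₁) (cong (T ^_) (sym c≡Tc₁))) ⟩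
      2 ^ (32 * c₁) * T ^ c ∎)
      where
      open ≤-Reasoning
      c≡Tc₁ : c ≡ T * c₁
      c≡Tc₁ = trans c≡c₁T (*-comm c₁ T)

    h₂ : (c * s * (T + 3 * 4)) ^ n * T ^ r ≤ A₂ * (T * (c * s)) ^ n
    h₂ = begin
      (c * s * (T + 12)) ^ n * T ^ r                     ≡⟨ cong (_* T ^ r) (^-distribʳ-* (c * s) (T + 12) n) ⟩
      (c * s) ^ n * (T + 12) ^ n * T ^ r                 ≤⟨ *-monoˡ-≤ (T ^ r) (*-monoʳ-≤ ((c * s) ^ n) [T+12]^n≤) ⟩
      (c * s) ^ n * (2 ^ (32 * c₁) * T ^ n) * T ^ r      ≡⟨ rearrange ((c * s) ^ n) (2 ^ (32 * c₁)) (T ^ n) (T ^ r) ⟩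
      A₂ * (T ^ n * (c * s) ^ n)                         ≡⟨ cong (A₂ *_) (^-distribʳ-* T (c * s) n) ⟨
      A₂ * (T * (c * s)) ^ n ∎
      where
      open ≤-Reasoning
      rearrange : ∀ p q t u → p * (q * t) * u ≡ q * u * (t * p)
      rearrange = solve-∀

    k≤L : k ≤ L n
    k≤L = begin
      k                                           ≤⟨ m≤n*m k (3 * (j * e) * e) {{m*n≢0 (3 * (j * e)) e {{m*n≢0 3 (j * e) {{_}} {{m*n≢0 j e {{>-nonZero (≤-trans (s≤s z≤n) 5≤j)}}}}}}}} ⟩
      3 * (j * e) * e * k                         ≡⟨ *-assoc (3 * (j * e)) e k ⟩
      3 * (j * e) * (e * k)                       ≡⟨ ⌊log₂[2^n]⌋≡n _ ⟨
      ⌊log₂ 2 ^ (3 * (j * e) * (e * k)) ⌋         ≤⟨ ⌊log₂⌋-mono-≤ large ⟩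
      L n ∎
      where open ≤-Reasoning

    -- Taking logarithms, with `c ≤ 2 * n`, `s ≤ n` and `k ≤ L n`. The additive constants are
    -- absorbed by `1 ≤ k ≤ L n`.
    clique-bound : ∀ x → k ^ x ≤ 2 * A₁ → x * j ≤ 8 * L n
    clique-bound x h = begin
      x * j                         ≡⟨ *-comm x j ⟩
      j * x                         ≤⟨ 2^-cancel-≤ {j * x} {1 + (1 + (M + M) + 2 * k)} power ⟩
      1 + (1 + (M + M) + 2 * k)     ≤⟨ +-monoʳ-≤ 1 (+-monoʳ-≤ (1 + (M + M)) (*-monoʳ-≤ 2 k≤L)) ⟩
      1 + (1 + (M + M) + 2 * L n)   ≡⟨ collect (L n) ⟩
      4 + 4 * L n                   ≤⟨ +-monoˡ-≤ (4 * L n) (*-monoʳ-≤ 4 (≤-trans (>-nonZero⁻¹ k) k≤L)) ⟩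
      4 * L n + 4 * L n             ≡⟨ double (L n) ⟩
      8 * L n ∎
      where
      open ≤-Reasoning
      M = suc (L n)
      collect : ∀ l → 1 + (1 + (1 + l + (1 + l)) + 2 * l) ≡ 4 + 4 * l
      collect = solve-∀
      double : ∀ l → 4 * l + 4 * l ≡ 8 * l
      double = solve-∀
      n≤2^M : n ≤ 2 ^ M
      n≤2^M = <⇒≤ (n<2^[1+⌊log₂n⌋] n)
      power : 2 ^ (j * x) ≤ 2 ^ (1 + (1 + (M + M) + 2 * k))
      power = begin
        2 ^ (j * x)                                  ≡⟨ ^-*-assoc 2 j x ⟨
        k ^ x                                        ≤⟨ h ⟩
        2 * (c * s * 2 ^ (2 * k))                    ≤⟨ *-monoʳ-≤ 2 (*-monoˡ-≤ (2 ^ (2 * k)) (*-mono-≤ c≤2n s≤n)) ⟩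
        2 * (2 * n * n * 2 ^ (2 * k))                ≤⟨ *-monoʳ-≤ 2 (*-monoˡ-≤ (2 ^ (2 * k)) (*-mono-≤ (*-monoʳ-≤ 2 n≤2^M) n≤2^M)) ⟩
        2 * (2 * 2 ^ M * 2 ^ M * 2 ^ (2 * k))        ≡⟨ cong (λ p → 2 * (p * 2 ^ (2 * k))) (trans (*-assoc 2 (2 ^ M) _) (cong (2 *_) (sym (^-distribˡ-+-* 2 M M)))) ⟩
        2 * (2 ^ (1 + (M + M)) * 2 ^ (2 * k))        ≡⟨ cong (2 *_) (^-distribˡ-+-* 2 (1 + (M + M)) (2 * k)) ⟨
        2 ^ (1 + (1 + (M + M) + 2 * k)) ∎

    independence-bound : ∀ x → 4 ^ x ≤ 2 * A₂ → x * T ≤ 35 * n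
    independence-bound x h = *-cancelˡ-≤ 2 (begin
      2 * (x * T)        ≡⟨ *-assoc 2 x T ⟨
      2 * x * T          ≤⟨ *-monoˡ-≤ T exponent ⟩
      35 * c₁ * T        ≡⟨ *-assoc 35 c₁ T ⟩
      35 * (c₁ * T)      ≡⟨ cong (35 *_) c≡c₁T ⟨
      35 * c             ≤⟨ *-monoʳ-≤ 35 c≤2n ⟩
      35 * (2 * n)       ≡⟨ *-swapˡ 35 2 n ⟩
      2 * (35 * n) ∎)
      where
      open ≤-Reasoning
      je≤T : j * e ≤ T
      je≤T = ≤-trans (<⇒≤ (n<2^n (j * e))) (≤-reflexive (sym T≡))
      instance
        q≢0 : NonZero q
        q≢0 = m*n≢0 ℓ _ {{_}} {{m^n≢0 b (pred (e * k))}}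
        qT≢0 : NonZero (q * T)
        qT≢0 = m*n≢0 q T
      T≤c₁ : T ≤ c₁
      T≤c₁ = m≤n*m T (q * T)
      -- The choice `b = T * T * T` pays here: `r` is about `c / (T * T)`, so even with
      -- `log₂ T = j * e` bounded only by `T`, the budget `T ^ r` has logarithm of order
      -- `c / T = c₁`.
      rT≤ : j * e * r ≤ 2 * c₁
      rT≤ = begin
        j * e * (T * q + 1)     ≤⟨ *-monoˡ-≤ (T * q + 1) je≤T ⟩
        T * (T * q + 1)         ≡⟨ expand T q ⟩
        c₁ + T                  ≤⟨ +-monoʳ-≤ c₁ T≤c₁ ⟩
        c₁ + c₁                 ≡⟨ cong (c₁ +_) (+-identityʳ c₁) ⟨
        2 * c₁ ∎
        where
        expand : ∀ T q → T * (T * q + 1) ≡ q * T * T + T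
        expand = solve-∀
      power : 2 ^ (2 * x) ≤ 2 ^ (1 + (32 * c₁ + j * e * r))
      power = begin
        2 ^ (2 * x)                                ≡⟨ ^-*-assoc 2 2 x ⟨
        4 ^ x                                      ≤⟨ h ⟩
        2 * (2 ^ (32 * c₁) * T ^ r)                ≡⟨ cong (λ p → 2 * (2 ^ (32 * c₁) * p)) (trans (cong (_^ r) T≡) (^-*-assoc 2 (j * e) r)) ⟩
        2 * (2 ^ (32 * c₁) * 2 ^ (j * e * r))      ≡⟨ cong (2 *_) (^-distribˡ-+-* 2 (32 * c₁) _) ⟨
        2 ^ (1 + (32 * c₁ + j * e * r)) ∎
      exponent : 2 * x ≤ 35 * c₁
      exponent = begin
        2 * x                               ≤⟨ 2^-cancel-≤ power ⟩
        1 + (32 * c₁ + j * e * r)           ≤⟨ +-mono-≤ (≤-trans (>-nonZero⁻¹ T) T≤c₁) (+-monoʳ-≤ (32 * c₁) rT≤) ⟩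
        c₁ + (32 * c₁ + 2 * c₁)             ≡⟨ total c₁ ⟩
        35 * c₁ ∎
        where
        total : ∀ c → c + (32 * c + 2 * c) ≡ 35 * c
        total = solve-∀

  construction : Σ (Family (suc e) n) λ F → Injective _≡_ _≡_ F
    × ((S : Subset n) → IsClique F S → ∣ S ∣ * j ≤ 8 * L n)
    × ((S : Subset n) → IsIndependent F S → ∣ S ∣ * (2 ^ j) ^ e ≤ 35 * n)
  construction =
    let F , injective , cliques , independents = Realization.box-family b e k ℓ n k 4 r A₁ A₂ h₁ hr h₂ in
    F , injective
    , (λ S clique → clique-bound ∣ S ∣ (cliques S clique))
    , (λ S independent → independence-bound ∣ S ∣ (independents S independent))

-- The constants

-- A downward search from `suc N`, where `g` already exceeds `N`.
last-below : (g : ℕ → ℕ) → g 0 ≡ 0 → (∀ m → m ≤ g m) → ∀ N → ∃ λ j → g j ≤ N × N < g (suc j)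
last-below g g0 g≥ N = go (suc N) (g≥ (suc N))
  where
  go : ∀ m → N < g m → ∃ λ j → g j ≤ N × N < g (suc j)
  go zero    N<g = contradiction (subst (N <_) g0 N<g) λ ()
  go (suc m) N<g with N <? g m
  ... | yes N<gm = go m N<gm
  ... | no  N≮gm = m , ≮⇒≥ N≮gm , N<g

L≤n : ∀ n → L n ≤ n
L≤n zero      = z≤n
L≤n n@(suc _) = ≤-trans (<⇒≤ (n<2^n (L n))) (2^⌊log₂n⌋≤n n (s≤s z≤n))

module Assembly (e′ : ℕ) where
  e : ℕ
  e = suc e′

  opaque
    -- The base 2 logarithm of the cell volume for the parameter `j`. It is opaque so that `bits 5`
    -- stays symbolic.
    bits : ℕ → ℕ
    bits j = 3 * (j * e) * (e * 2 ^ j)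

    bits-zero : bits 0 ≡ 0
    bits-zero = refl

    2^bits : ∀ {j n} → 2 ^ bits j ≤ n → 2 ^ (3 * (j * e) * (e * 2 ^ j)) ≤ n
    2^bits h = h

    bits-mono : ∀ {i j} → i ≤ j → bits i ≤ bits j
    bits-mono i≤j = *-mono-≤ (*-monoʳ-≤ 3 (*-monoˡ-≤ e i≤j)) (*-monoʳ-≤ e (^-monoʳ-≤ 2 i≤j))

    2^j≤bits : ∀ j → 0 < j → 2 ^ j ≤ bits j
    2^j≤bits j@(suc _) 0<j = ≤-trans (m≤n*m (2 ^ j) e) (m≤n*m (e * 2 ^ j) (3 * (j * e)))

    j≤bits : ∀ j → j ≤ bits j
    j≤bits zero      = z≤n
    j≤bits j@(suc _) = ≤-trans (<⇒≤ (n<2^n j)) (2^j≤bits j (s≤s z≤n))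

    -- Consecutive thresholds differ by a bounded factor, so the largest admissible `j` determines
    -- `L n` up to a constant.
    bits-suc : ∀ j → 0 < j → bits (suc j) ≤ 12 * e * e * (j * 2 ^ j)
    bits-suc j 0<j = begin
      3 * (suc j * e) * (e * (2 * 2 ^ j))        ≤⟨ *-monoˡ-≤ (e * (2 * 2 ^ j)) (*-monoʳ-≤ 3 (*-monoˡ-≤ e (+-monoˡ-≤ j 0<j))) ⟩
      3 * ((j + j) * e) * (e * (2 * 2 ^ j))      ≡⟨ collect j e (2 ^ j) ⟩
      12 * e * e * (j * 2 ^ j) ∎
      where
      open ≤-Reasoning
      collect : ∀ j e p → 3 * ((j + j) * e) * (e * (2 * p)) ≡ 12 * e * e * (j * p)
      collect = solve-∀

  -- In `C₁` and `C₂` the first summand serves `L n < bits 5`, the second all larger `n`.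
  K C₁ C₂ : ℕ
  K  = 12 * e * e
  C₁ = 2 ^ bits 5 + (K + 2) * 8
  C₂ = bits 5 ^ e + K ^ e * 35

  Bounded : ∀ {n} → Family (suc e) n → Set
  Bounded {n} F = CliqueNumberAtMost F (C₁ * L n) (LL n)
                × IndependenceNumberAtMost F (C₂ * n * LL n ^ e) (L n ^ e)

  LL>0 : ∀ n → 4 ≤ n → 0 < LL n
  LL>0 n 4≤n = ⌊log₂⌋-mono-≤ (⌊log₂⌋-mono-≤ 4≤n)

  points : ∀ n → Family (suc e) n
  points n i = box (λ _ → pos (toℕ i)) (λ _ → pos (toℕ i)) (λ _ → ℤ.≤-refl)

  points-injective : ∀ n → Injective _≡_ _≡_ (points n)
  points-injective n eq = toℕ-injective (ℤ.+-injective (cong (λ B → lo B zero) eq))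

  -- Here `n` is bounded in terms of `e`, so `∣ S ∣ ≤ n` suffices and any distinct boxes will do.
  small : ∀ n → 4 ≤ n → L n < bits 5 → Bounded (points n)
  small n 4≤n L< = (λ S _ → clique S) , (λ S _ → independence S)
    where
    open ≤-Reasoning
    clique : (S : Subset n) → ∣ S ∣ * LL n ≤ C₁ * L n
    clique S = begin
      ∣ S ∣ * LL n            ≤⟨ *-mono-≤ (∣p∣≤n S) (L≤n (L n)) ⟩
      n * L n                 ≤⟨ *-monoˡ-≤ (L n) (≤-trans (<⇒≤ (n<2^[1+⌊log₂n⌋] n)) (^-monoʳ-≤ 2 L<)) ⟩
      2 ^ bits 5 * L n        ≤⟨ *-monoˡ-≤ (L n) (m≤m+n (2 ^ bits 5) _) ⟩
      C₁ * L n ∎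
    independence : (S : Subset n) → ∣ S ∣ * L n ^ e ≤ C₂ * n * LL n ^ e
    independence S = begin
      ∣ S ∣ * L n ^ e          ≤⟨ *-mono-≤ (∣p∣≤n S) (^-monoˡ-≤ e (<⇒≤ L<)) ⟩
      n * bits 5 ^ e           ≡⟨ *-comm n _ ⟩
      bits 5 ^ e * n           ≤⟨ *-monoˡ-≤ n (m≤m+n (bits 5 ^ e) _) ⟩
      C₂ * n                   ≤⟨ m≤m*n (C₂ * n) (LL n ^ e) {{m^n≢0 (LL n) e {{>-nonZero (LL>0 n 4≤n)}}}} ⟩
      C₂ * n * LL n ^ e ∎

  -- Up to constant factors `L n` is `j * 2 ^ j` and `LL n` is `j`, so `2 ^ j` has the order of
  -- `L n / LL n`.
  large : ∀ n j → 4 ≤ n → 5 ≤ j → bits j ≤ L n → L n < bits (suc j) →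
    Σ (Family (suc e) n) λ F → Injective _≡_ _≡_ F × Bounded F
  large n j 4≤n 5≤j bits≤ <bits =
    let F , injective , cliques , independents = Construction.construction e′ j n 5≤j {{n≢0}} (2^bits {j} 2^bits≤n)
    in F , injective
     , (λ S clique → clique-bound ∣ S ∣ (cliques S clique))
     , (λ S independent → independence-bound ∣ S ∣ (independents S independent))
    where
    open ≤-Reasoning
    n≢0 : NonZero n
    n≢0 = >-nonZero (≤-trans (s≤s z≤n) 4≤n)
    0<j : 0 < j
    0<j = ≤-trans (s≤s z≤n) 5≤j
    2^bits≤n : 2 ^ bits j ≤ n
    2^bits≤n = ≤-trans (^-monoʳ-≤ 2 bits≤) (2^⌊log₂n⌋≤n n (≤-trans (s≤s z≤n) 4≤n))
    L≤ : L n ≤ K * (j * 2 ^ j)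
    L≤ = ≤-trans (<⇒≤ <bits) (bits-suc j 0<j)
    LL≤ : LL n ≤ (K + 2) * j
    LL≤ = begin
      -- `K` and `j` are replaced by `2 ^ K` and `2 ^ j`, so that the logarithm is taken of a power
      -- of two.
      LL n                                   ≤⟨ ⌊log₂⌋-mono-≤ (≤-trans L≤ (*-mono-≤ (<⇒≤ (n<2^n K)) (*-monoˡ-≤ (2 ^ j) (<⇒≤ (n<2^n j))))) ⟩
      ⌊log₂ 2 ^ K * (2 ^ j * 2 ^ j) ⌋        ≡⟨ cong ⌊log₂_⌋ (trans (cong (2 ^ K *_) (sym (^-distribˡ-+-* 2 j j))) (sym (^-distribˡ-+-* 2 K (j + j)))) ⟩
      ⌊log₂ 2 ^ (K + (j + j)) ⌋              ≡⟨ ⌊log₂[2^n]⌋≡n (K + (j + j)) ⟩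
      K + (j + j)                            ≤⟨ +-monoˡ-≤ (j + j) (m≤m*n K j {{>-nonZero 0<j}}) ⟩
      K * j + (j + j)                        ≡⟨ collect K j ⟩
      (K + 2) * j ∎
      where
      collect : ∀ K j → K * j + (j + j) ≡ (K + 2) * j
      collect = solve-∀
    j≤LL : j ≤ LL n
    j≤LL = ≤-trans (≤-reflexive (sym (⌊log₂[2^n]⌋≡n j)))
      (⌊log₂⌋-mono-≤ (≤-trans (2^j≤bits j 0<j) bits≤))
    clique-bound : ∀ x → x * j ≤ 8 * L n → x * LL n ≤ C₁ * L n
    clique-bound x h = begin
      x * LL n                 ≤⟨ *-monoʳ-≤ x LL≤ ⟩
      x * ((K + 2) * j)        ≡⟨ *-swapˡ x (K + 2) j ⟩
      (K + 2) * (x * j)        ≤⟨ *-monoʳ-≤ (K + 2) h ⟩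
      (K + 2) * (8 * L n)      ≡⟨ *-assoc (K + 2) 8 (L n) ⟨
      (K + 2) * 8 * L n        ≤⟨ *-monoˡ-≤ (L n) (m≤n+m ((K + 2) * 8) (2 ^ bits 5)) ⟩
      C₁ * L n ∎
    independence-bound : ∀ x → x * (2 ^ j) ^ e ≤ 35 * n → x * L n ^ e ≤ C₂ * n * LL n ^ e
    independence-bound x h = begin
      -- By `j ≤ LL n`, the ratio of `L n` to `LL n` is at most `K * 2 ^ j`.
      x * L n ^ e                              ≤⟨ *-monoʳ-≤ x (^-monoˡ-≤ e (≤-trans L≤ (*-monoʳ-≤ K (*-monoˡ-≤ (2 ^ j) j≤LL)))) ⟩
      x * (K * (LL n * 2 ^ j)) ^ e             ≡⟨ cong (x *_) (trans (^-distribʳ-* K (LL n * 2 ^ j) e) (cong (K ^ e *_) (^-distribʳ-* (LL n) (2 ^ j) e))) ⟩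
      x * (K ^ e * (LL n ^ e * (2 ^ j) ^ e))   ≡⟨ rearrange x (K ^ e) (LL n ^ e) ((2 ^ j) ^ e) ⟩
      K ^ e * (x * (2 ^ j) ^ e) * LL n ^ e     ≤⟨ *-monoˡ-≤ (LL n ^ e) (*-monoʳ-≤ (K ^ e) h) ⟩
      K ^ e * (35 * n) * LL n ^ e              ≡⟨ cong (_* LL n ^ e) (*-assoc (K ^ e) 35 n) ⟨
      K ^ e * 35 * n * LL n ^ e                ≤⟨ *-monoˡ-≤ (LL n ^ e) (*-monoˡ-≤ n (m≤n+m (K ^ e * 35) (bits 5 ^ e))) ⟩
      C₂ * n * LL n ^ e ∎
      where
      rearrange : ∀ x p q r → x * (p * (q * r)) ≡ p * (x * r) * q
      rearrange = solve-∀

  bounded-family : ∀ n → 4 ≤ n → Σ (Family (suc e) n) λ F → Injective _≡_ _≡_ F × Bounded F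
  bounded-family n 4≤n with L n <? bits 5
  ... | yes L<bits5 = points n , points-injective n , small n 4≤n L<bits5
  ... | no  L≮bits5 with last-below bits bits-zero j≤bits (L n)
  ...   | j , bits≤ , <bits with 5 ≤? j
  ...     | yes 5≤j = large n j 4≤n 5≤j bits≤ <bits
  ...     | no  5≰j = contradiction (<-≤-trans <bits (bits-mono (≰⇒> 5≰j))) L≮bits5

theorem4 : (d : ℕ) → 3 ≤ d →
    Σ ℕ (λ c₁ → Σ ℕ (λ c₂ → (n : ℕ) → 4 ≤ n →
      Σ (Family d n) (λ F →
        Injective _≡_ _≡_ F
        × CliqueNumberAtMost F (c₁ * L n) (LL n)
        × IndependenceNumberAtMost F (c₂ * n * LL n ^ (d ∸ 1)) (L n ^ (d ∸ 1)))))
theorem4 (suc (suc e′)) 3≤d = Assembly.C₁ e′ , Assembly.C₂ e′ , Assembly.bounded-family e′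
theorem4 (suc zero) (s≤s ())
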